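{- Let $R_1$ be the optimal expected rendezvous time of oblivious self-distance strategies for initial separation $2d=2$ (i.e. $d=1$), and let $U_{1,2}(a_1)$ be the expected absorption time of the level-$2$ truncated chain (for $d=1$) with parameter $a_1\in[0,1]$. Then $$R_1\approx 6.4670988308 .$$ Moreover, $R_1$ is attained by a level-$2$ truncated chain with parameter $a_1^\ast\approx 0.1992570042$, where $a_1^\ast$ is the unique root in $(0,1)$ of $$-12+52x+39x^2+12x^3-3x^4 .$$ Thus the exact value is $R_1=U_{1,2}(a_1^\ast)$.
   Context: Model. An admissible strategy is a sequence $a=(a_i)_{i\ge 0}$ with $a_i\in[0,1]$ and $a_0=\tfrac12$; $\mathcal A$ is the set of admissible strategies. Extend $a$ to a signed sequence $(b_i)_{i\in\mathbb Z}$ by $b_i=a_i$ for $i\ge0$ and $b_i=1-a_{ -i}$ for $i<0$. Two independent Markov chains $(X_t)_{t\ge0},(Y_t)_{t\ge 0}$ on $\mathbb Z$ start at $X_0=Y_0=0$; each moves from $k$ to $k+1$ with probability $b_k$ and to $k-1$ with probability $1-b_k$. (These are the displacements of two agents from their starting points $-d$ and $d$.) For an integer $d\ge1$ the rendezvous time is $\mathcal T_d(a)=\inf\{t\ge0: X_t=Y_t+2d\}$, and $$R_d=\inf_{a\in\mathcal A}\mathbb E[\mathcal T_d(a)].$$ Truncated chain. Fix $d\ge1$, $n\ge d$ and $a=(a_1,\dots,a_{n-1})\in[0,1]^{n-1}$. Set $a_0=\frac12$, $a_i=0$ for $i\ge n$, and let $(b_i)$ be the signed sequence. The level-$n$ truncated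 chain has states $S_{x,y}$ with $-n\le x,y\le n$, $x-y\le 2d$, $x-y$ even; states with $x-y=2d$ are absorbing; from any other state $S_{x,y}$ the two coordinates move independently, $x\mapsto x+1$ with probability $b_x$ and $x\mapsto x-1$ otherwise, $y\mapsto y+1$ with probability $b_y$ and $y\mapsto y-1$ otherwise. $U_{d,n}(a)\in[0,\infty]$ is the expected hitting time of the absorbing set starting from $S_{0,0}$ ($\infty$ if not finite). The truncated chain with parameters $a$ is the rendezvous process of the admissible strategy $(\frac12,a_1,\dots,a_{n-1},0,0,\dots)$. The symbol $\approx$ denotes a numerical approximation, with no error tolerance specified; the exact content is the identity $R_1=U_{1,2}(a_1^\ast)$ with $a_1^\ast$ the stated root. -}

module Defs where

open import Level using (0ℓ)
open import Algebra.Bundles using (CommutativeRing)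
import Algebra.Properties.Semiring.Exp as Exp
import Algebra.Properties.Semiring.Mult as Mult
open import Axiom.ExcludedMiddle using (ExcludedMiddle)
open import Data.Bool.Base using (if_then_else_)
open import Data.Empty using (⊥)
open import Data.Fin.Base using (toℕ)
open import Data.Integer.Base as ℤ using (ℤ; +_; -[1+_])
import Data.Integer.Divisibility.Signed as ℤ
import Data.Integer.Properties as ℤ
open import Data.List.Base as List using (List; []; _∷_; applyUpTo; cartesianProductWith; concatMap; filter; findIndex; foldr; mapMaybe)
open import Data.Maybe.Base as Maybe using (Maybe; just)
import Data.Maybe.Properties as Maybe
open import Data.Nat.Base as ℕ using (ℕ; zero; suc; _∸_; z≤n)
import Data.Nat.Properties as ℕ
open import Data.Product.Base using (Σ; ∃; _×_; _,_; proj₁; map₂)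
open import Data.Sum.Base using (_⊎_; inj₁)
open import Data.Unit.Base using (⊤)
open import Data.Vec.Base using (Vec; []; _∷_)
open import Relation.Binary.Core using (Rel)
open import Relation.Binary.PropositionalEquality.Core as ≡ using (_≡_)
open import Relation.Binary.Structures using (IsTotalOrder)
import Relation.Binary.Construct.NonStrictToStrict as ToStrict
open import Relation.Nullary.Decidable using (yes; no; does; dec⇒maybe; _×-dec_)
open import Relation.Nullary.Negation.Core using (¬_)
open import Relation.Unary using (Decidable)

-- The axioms of the real numbers, which determine them up to isomorphism.
record CompleteOrderedField : Set₁ where
  infix 4 _≤_
  infix 9 _⁻¹
  field
    commutativeRing : CommutativeRing 0ℓ 0ℓ
  open CommutativeRing commutativeRing public
  field
    _≤_          : Rel Carrier 0ℓ
    isTotalOrder : IsTotalOrder _≈_ _≤_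
    +-monoˡ-≤    : ∀ z {x y} → x ≤ y → x + z ≤ y + z
    *-nonneg     : ∀ {x y} → 0# ≤ x → 0# ≤ y → 0# ≤ x * y
    0≉1          : ¬ 0# ≈ 1#
    -- The value of 0# ⁻¹ is unspecified.
    _⁻¹          : Carrier → Carrier
    *-inverseʳ   : ∀ x → ¬ x ≈ 0# → x * x ⁻¹ ≈ 1#

  UpperBound : (Carrier → Set) → Carrier → Set
  UpperBound P u = ∀ x → P x → x ≤ u

  IsLeastUpperBound : (Carrier → Set) → Carrier → Set
  IsLeastUpperBound P u = UpperBound P u × (∀ v → UpperBound P v → u ≤ v)

  field
    complete : ∀ (P : Carrier → Set) → ∃ P → ∃ (UpperBound P) →
               ∃ (IsLeastUpperBound P)

  open ToStrict _≈_ _≤_ public using (_<_)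
  open Exp semiring public using (_^_)
  open Mult semiring using () renaming (_×_ to _·_)

  fromℕ : ℕ → Carrier
  fromℕ n = n · 1#

  infixl 7 _/_
  _/_ : Carrier → Carrier → Carrier
  x / y = x * y ⁻¹

  ½ : Carrier
  ½ = 1# / fromℕ 2

  ∑ : List Carrier → Carrier
  ∑ = foldr _+_ 0#

  -- ∣ x - y ∣ ≤ ε
  infix 4 _≈_±_
  _≈_±_ : Carrier → Carrier → Carrier → Set
  x ≈ y ± ε = (y - ε ≤ x) × (x ≤ y + ε)

module Rendezvous (em : ExcludedMiddle 0ℓ) (ℝ : CompleteOrderedField) where

  open CompleteOrderedField ℝ

  data ℝ∞ : Set where
    fin : Carrier → ℝ∞
    ∞   : ℝ∞

  infix 4 _≤∞_ _≈∞_

  _≤∞_ : ℝ∞ → ℝ∞ → Set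
  _     ≤∞ ∞     = ⊤
  fin x ≤∞ fin y = x ≤ y
  ∞     ≤∞ fin _ = ⊥

  _≈∞_ : ℝ∞ → ℝ∞ → Set
  fin x ≈∞ fin y = x ≈ y
  ∞     ≈∞ ∞     = ⊤
  fin _ ≈∞ ∞     = ⊥
  ∞     ≈∞ fin _ = ⊥

  -- Supremum taken in [0,∞]: 0 is adjoined, so the empty set has supremum 0.
  sup∞ : (Carrier → Set) → ℝ∞
  sup∞ P with em {∃ (UpperBound (λ x → x ≈ 0# ⊎ P x))}
  ... | yes bounded = fin (proj₁ (complete _ (0# , inj₁ refl) bounded))
  ... | no  _       = ∞

  inf∞ : (ℝ∞ → Set) → ℝ∞
  inf∞ Q = sup∞ (λ x → ∀ y → Q y → fin x ≤∞ y)

  -- Sum of a series of nonnegative terms.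
  ∑∞ : (ℕ → Carrier) → ℝ∞
  ∑∞ f = sup∞ (λ s → ∃ λ N → s ≈ ∑ (applyUpTo f N))

  -- Finitely supported distributions, as lists of weighted outcomes; an outcome
  -- may be listed several times, and the weights are not required to sum to 1#.
  Dist : Set → Set
  Dist A = List (Carrier × A)

  return : ∀ {A} → A → Dist A
  return x = (1# , x) ∷ []

  infixl 1 _>>=_
  _>>=_ : ∀ {A B} → Dist A → (A → Dist B) → Dist B
  μ >>= κ = concatMap (λ (p , x) → List.map (λ (q , y) → (p * q , y)) (κ x)) μ

  mapDist : ∀ {A B : Set} → (A → B) → Dist A → Dist B
  mapDist f = List.map (map₂ f)

  _⊗_ : ∀ {A B} → Dist A → Dist B → Dist (A × B)
  _⊗_ = cartesianProductWith (λ (p , x) (q , y) → (p * q , (x , y)))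

  prob : ∀ {A} {P : A → Set} → Dist A → Decidable P → Carrier
  prob μ P? = ∑ (List.map proj₁ (filter (λ (_ , x) → P? x) μ))

  module MarkovChain {S : Set} (step : S → Dist S)
                     {Target : S → Set} (target? : Decidable Target) where

    -- The law of the trajectory (s₀ , s₁ , … , sₜ).
    trajectory : ℕ → S → Dist (List S)
    trajectory zero    s = return (s ∷ [])
    trajectory (suc t) s = step s >>= λ s′ → mapDist (s ∷_) (trajectory t s′)

    hittingTime : List S → Maybe ℕ
    hittingTime ω = Maybe.map toℕ (findIndex target? ω)

    ℙ[T≡_]from_ : ℕ → S → Carrier
    ℙ[T≡ t ]from s =
      prob (trajectory t s) (λ ω → Maybe.≡-dec ℕ._≟_ (hittingTime ω) (just t))

    expectedHittingTime : S → ℝ∞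
    expectedHittingTime s =
      if does (em {∑∞ (λ t → ℙ[T≡ t ]from s) ≈∞ fin 1#})
      then ∑∞ (λ t → fromℕ t * ℙ[T≡ t ]from s)
      else ∞

  Admissible : (ℕ → Carrier) → Set
  Admissible a = (∀ i → 0# ≤ a i × a i ≤ 1#) × a 0 ≈ ½

  signed : (ℕ → Carrier) → ℤ → Carrier
  signed a (+ i)    = a i
  signed a -[1+ i ] = 1# - a (suc i)

  walk : (ℕ → Carrier) → ℤ → Dist ℤ
  walk a k = (signed a k , ℤ.suc k) ∷ (1# - signed a k , ℤ.pred k) ∷ []

  pairWalk : (ℕ → Carrier) → ℤ × ℤ → Dist (ℤ × ℤ)
  pairWalk a (x , y) = walk a x ⊗ walk a y

  Met : ℕ → ℤ × ℤ → Set
  Met d (x , y) = x ≡ y ℤ.+ + (2 ℕ.* d)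

  met? : ∀ d → Decidable (Met d)
  met? d (x , y) = x ℤ.≟ y ℤ.+ + (2 ℕ.* d)

  𝔼[T] : ℕ → (ℕ → Carrier) → ℝ∞
  𝔼[T] d a = MarkovChain.expectedHittingTime (pairWalk a) (met? d) (+ 0 , + 0)

  R : ℕ → ℝ∞
  R d = inf∞ (λ y → ∃ λ a → Admissible a × y ≈∞ 𝔼[T] d a)

  -- The sequence (½ , a₁ , … , aₘ , 0 , 0 , …).
  extend : ∀ {m} → Vec Carrier m → ℕ → Carrier
  extend as zero    = ½
  extend as (suc i) = pad as i
    where
    pad : ∀ {k} → Vec Carrier k → ℕ → Carrier
    pad []       _       = 0#
    pad (x ∷ _)  zero    = x
    pad (_ ∷ xs) (suc j) = pad xs j

  module _ (d n : ℕ) where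

    InRange : ℤ → Set
    InRange x = ℤ.- + n ℤ.≤ x × x ℤ.≤ + n

    inRange? : Decidable InRange
    inRange? x = (ℤ.- + n ℤ.≤? x) ×-dec (x ℤ.≤? + n)

    IsState : ℤ × ℤ → Set
    IsState (x , y) =
      InRange x × InRange y × x ℤ.- y ℤ.≤ + (2 ℕ.* d) × + 2 ℤ.∣ x ℤ.- y

    isState? : Decidable IsState
    isState? (x , y) =
      inRange? x ×-dec inRange? y ×-dec
      (x ℤ.- y ℤ.≤? + (2 ℕ.* d)) ×-dec (+ 2 ℤ.∣? x ℤ.- y)

    State : Set
    State = Σ (ℤ × ℤ) IsState

    Absorbing : State → Set
    Absorbing ((x , y) , _) = x ℤ.- y ≡ + (2 ℕ.* d)

    absorbing? : Decidable Absorbing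
    absorbing? ((x , y) , _) = x ℤ.- y ℤ.≟ + (2 ℕ.* d)

    -- From a non-absorbing state only moves out of [-n,n]² can leave the state
    -- space.  For n ≥ 1 they have weight 0, because extend as n is 0#, so
    -- discarding them leaves a probability distribution.
    truncatedStep : Vec Carrier (n ∸ 1) → State → Dist State
    truncatedStep as s@(xy , _) =
      if does (absorbing? s)
      then return s
      else mapMaybe (λ (p , z) → Maybe.map (λ z∈ → p , z , z∈) (dec⇒maybe (isState? z)))
                    (pairWalk (extend as) xy)

    origin : State
    origin = (+ 0 , + 0)
           , (ℤ.neg-≤-pos , ℤ.+≤+ z≤n)
           , (ℤ.neg-≤-pos , ℤ.+≤+ z≤n)
           , ℤ.+≤+ z≤n
           , ℤ.divides (+ 0) ≡.refl

    U : Vec Carrier (n ∸ 1) → ℝ∞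
    U as = MarkovChain.expectedHittingTime (truncatedStep as) absorbing? origin

  quartic : Carrier → Carrier
  quartic x = - fromℕ 12 + fromℕ 52 * x + fromℕ 39 * x ^ 2
            + fromℕ 12 * x ^ 3 - fromℕ 3 * x ^ 4

  -- x agrees with m / 10¹⁰ to ten decimal places, after rounding.
  infix 4 _≈10⁻¹⁰×_
  _≈10⁻¹⁰×_ : Carrier → ℕ → Set
  x ≈10⁻¹⁰× m = x ≈ fromℕ m / fromℕ 10 ^ 10 ± (½ / fromℕ 10 ^ 10)

{-# OPTIONS --safe #-}

-- Lower bound.  A bounded function h on the pairs of positions that vanishes at meetings
-- and satisfies h ≤ 1 + P h is at most 𝔼[T]: h is bounded by the expectation of
-- min (T , N) + M [ T ≥ N ], and if T is finite almost surely then letting N grow gives the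
-- claim.  Writing p = a₁, r = a₂ and t for the root of the quartic, such an h with
-- h (0 , 0) = α = U₁₂ (t) exists for every strategy, whatever a₃ , a₄ , … are.  In the
-- coordinates (x , y) = (n - j , n + j), and up to the symmetry n ↦ - n, it is
--   h (1 , 1) = u,  h (-1 , 1) = v,  h (0 , 2) = m + r g,
--   h (2 , 2) = 1 + (1 - r)² u + r (1 - r) h₁₃ + 5 r²,  h (n , n) = 5 for n ≥ 3,
-- and for the remaining states it depends on x only: 6, h₁₃, m, h₋₁₃, 1 + v for x ≥ 2,
-- x = 1, x = 0, x = -1, x ≤ -2.  Here u is linear in p, with the slope for which the
-- inequalities at (1 , 1) and (-1 , 1) for r = 0 become (p - t)² c₁ ≥ 0 and (p - t)² c₂ ≥ 0
-- modulo the quartic; v = 4 α - 4 - 2 u is forced by the state (0 , 0).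
--
-- Attainment.  For p = t and r = 0 the inequalities along the states that are actually
-- visited are equalities, so h (0 , 0) is the expected time, both for the strategy and for
-- the truncated chain.
--
-- All remaining inequalities are strict polynomial inequalities in (t , p), with t confined
-- to an interval of length 10⁻¹⁴; they are verified by evaluating Horner forms with integer
-- coefficients and bisecting in p.

module Submission where

open import Level using (0ℓ)
open import Axiom.ExcludedMiddle using (ExcludedMiddle)
import Algebra.Properties.CommutativeSemigroup as CommutativeSemigroupProperties
import Algebra.Properties.Ring as RingProperties
import Algebra.Properties.Semiring.Mult as SemiringMult
open import Data.Bool.Base using (Bool; true; false; _∧_; _∨_; if_then_else_)
open import Data.Fin.Base using (Fin; zero; suc)
open import Data.Fin.Patterns using (0F; 1F; 2F; 3F)
open import Data.Integer.Base as ℤ using (ℤ; +_; -[1+_])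
import Data.Integer.Properties as ℤ
import Data.Integer.Solver as ℤ
open import Data.List.Base as List using (List; []; _∷_; _++_; applyUpTo; mapMaybe)
open import Data.List.Relation.Unary.All as All using (All; []; _∷_)
open import Data.Maybe.Base as Maybe using (Maybe; just; nothing)
import Data.Maybe.Properties as Maybe
open import Data.Nat.Base as ℕ using (ℕ; zero; suc)
import Data.Nat.Properties as ℕ
open import Data.Product.Base using (_×_; _,_; proj₁; proj₂; ∃; ∃₂)
open import Data.Sum.Base using (_⊎_; inj₁; inj₂; [_,_]′)
open import Data.Unit.Base using (tt)
open import Data.Vec.Base as Vec using (Vec; []; _∷_; lookup; allFin)
open import Data.Vec.N-ary using (N-ary; _$ⁿ_; curryⁿ; Eq; curryⁿ-cong)
open import Data.Vec.Relation.Unary.All as VecAll using ([]; _∷_)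
open import Function.Base using (_∘_)
open import Relation.Binary.PropositionalEquality.Core as ≡ using (_≡_; cong; cong₂)
open import Relation.Binary.Structures using (IsTotalOrder)
open import Relation.Nullary.Decidable using (Dec; yes; no; does; isYes; toSum; toWitness; dec⇒maybe)
open import Relation.Nullary.Negation.Core using (¬_; contradiction)
open import Relation.Unary using (Decidable)
open import Defs
open ℤ.+-*-Solver using () renaming (solve to solveℤ; con to conℤ; _:+_ to _⊕_; _:-_ to _⊝_; _:=_ to _⊜_)

-- Consequences of the ordered field axioms, and the embedding of ℤ.

module OrderedField (ℝ : CompleteOrderedField) where

  open CompleteOrderedField ℝ
  private
    module R = RingProperties ring
    module O = IsTotalOrder isTotalOrder
    module M = SemiringMult semiring

  ≤-refl : ∀ {x} → x ≤ x
  ≤-refl = O.refl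

  ≤-reflexive : ∀ {x y} → x ≈ y → x ≤ y
  ≤-reflexive = O.reflexive

  ≤-trans : ∀ {x y z} → x ≤ y → y ≤ z → x ≤ z
  ≤-trans = O.trans

  ≤-antisym : ∀ {x y} → x ≤ y → y ≤ x → x ≈ y
  ≤-antisym = O.antisym

  ≤-total : ∀ x y → x ≤ y ⊎ y ≤ x
  ≤-total = O.total

  ≤-resp : ∀ {x x′ y y′} → x ≈ x′ → y ≈ y′ → x ≤ y → x′ ≤ y′
  ≤-resp x≈x′ y≈y′ x≤y = ≤-trans (≤-reflexive (sym x≈x′)) (≤-trans x≤y (≤-reflexive y≈y′))

  +-monoʳ-≤ : ∀ z {x y} → x ≤ y → z + x ≤ z + y
  +-monoʳ-≤ z x≤y = ≤-resp (+-comm _ z) (+-comm _ z) (+-monoˡ-≤ z x≤y)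

  +-mono-≤ : ∀ {x y u v} → x ≤ y → u ≤ v → x + u ≤ y + v
  +-mono-≤ x≤y u≤v = ≤-trans (+-monoˡ-≤ _ x≤y) (+-monoʳ-≤ _ u≤v)

  +-nonneg : ∀ {x y} → 0# ≤ x → 0# ≤ y → 0# ≤ x + y
  +-nonneg 0≤x 0≤y = ≤-resp (+-identityˡ 0#) refl (+-mono-≤ 0≤x 0≤y)

  x≤y⇒0≤y-x : ∀ {x y} → x ≤ y → 0# ≤ y - x
  x≤y⇒0≤y-x {x} x≤y = ≤-resp (-‿inverseʳ x) refl (+-monoˡ-≤ (- x) x≤y)

  0≤y-x⇒x≤y : ∀ {x y} → 0# ≤ y - x → x ≤ y
  0≤y-x⇒x≤y {x} {y} 0≤y-x = ≤-resp (+-identityˡ x)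
    (trans (+-assoc y (- x) x) (trans (+-congˡ (-‿inverseˡ x)) (+-identityʳ y)))
    (+-monoˡ-≤ x 0≤y-x)

  -‿anti-≤ : ∀ {x y} → x ≤ y → - y ≤ - x
  -‿anti-≤ {x} {y} x≤y = 0≤y-x⇒x≤y
    (≤-resp refl (trans (+-comm y (- x)) (+-congˡ (sym (R.-‿involutive y)))) (x≤y⇒0≤y-x x≤y))

  x≤0⇒0≤-x : ∀ {x} → x ≤ 0# → 0# ≤ - x
  x≤0⇒0≤-x x≤0 = ≤-resp R.-0#≈0# refl (-‿anti-≤ x≤0)

  *-monoˡ-≤ : ∀ {x y z} → 0# ≤ z → x ≤ y → z * x ≤ z * y
  *-monoˡ-≤ {x} {y} {z} 0≤z x≤y = 0≤y-x⇒x≤y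
    (≤-resp refl (trans (distribˡ z y (- x)) (+-congˡ (sym (R.-‿distribʳ-* z x))))
      (*-nonneg 0≤z (x≤y⇒0≤y-x x≤y)))

  *-monoʳ-≤ : ∀ {x y z} → 0# ≤ z → x ≤ y → x * z ≤ y * z
  *-monoʳ-≤ {x} {y} {z} 0≤z x≤y = ≤-resp (*-comm z x) (*-comm z y) (*-monoˡ-≤ 0≤z x≤y)

  sq-nonneg : ∀ x → 0# ≤ x * x
  sq-nonneg x with ≤-total 0# x
  ... | inj₁ 0≤x = *-nonneg 0≤x 0≤x
  ... | inj₂ x≤0 = ≤-resp refl
    (trans (sym (R.-‿distribˡ-* x (- x))) (trans (-‿cong (sym (R.-‿distribʳ-* x x))) (R.-‿involutive (x * x))))
    (*-nonneg (x≤0⇒0≤-x x≤0) (x≤0⇒0≤-x x≤0))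

  0≤1 : 0# ≤ 1#
  0≤1 = ≤-resp refl (*-identityˡ 1#) (sq-nonneg 1#)

  0<1 : 0# < 1#
  0<1 = 0≤1 , 0≉1

  <⇒≱ : ∀ {x y} → x < y → ¬ y ≤ x
  <⇒≱ (x≤y , x≉y) y≤x = x≉y (≤-antisym x≤y y≤x)

  ≰⇒> : ∀ {x y} → ¬ x ≤ y → y < x
  ≰⇒> {x} {y} x≰y with ≤-total x y
  ... | inj₁ x≤y = contradiction x≤y x≰y
  ... | inj₂ y≤x = y≤x , λ y≈x → x≰y (≤-reflexive (sym y≈x))

  <-≤-trans : ∀ {x y z} → x < y → y ≤ z → x < z
  <-≤-trans (x≤y , x≉y) y≤z =
    ≤-trans x≤y y≤z , λ x≈z → x≉y (≤-antisym x≤y (≤-trans y≤z (≤-reflexive (sym x≈z))))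

  -- `x ⁻¹` equals `x * (x ⁻¹ * x ⁻¹)`, a product of nonnegative factors.
  ⁻¹-pos : ∀ {x} → 0# < x → 0# ≤ x ⁻¹
  ⁻¹-pos {x} (0≤x , 0≉x) = ≤-resp refl
    (trans (sym (*-assoc x (x ⁻¹) (x ⁻¹)))
      (trans (*-congʳ (*-inverseʳ x (λ x≈0 → 0≉x (sym x≈0)))) (*-identityˡ (x ⁻¹))))
    (*-nonneg 0≤x (sq-nonneg (x ⁻¹)))

  *-inverse-pos : ∀ {x} → 0# < x → x * x ⁻¹ ≈ 1#
  *-inverse-pos {x} (_ , 0≉x) = *-inverseʳ x (λ x≈0 → 0≉x (sym x≈0))

  *-cancelˡ-≤ : ∀ {x y z} → 0# < z → z * x ≤ z * y → x ≤ y
  *-cancelˡ-≤ {x} {y} {z} 0<z zx≤zy =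
    ≤-resp (cancel x) (cancel y) (*-monoˡ-≤ (⁻¹-pos 0<z) zx≤zy)
    where
    cancel : ∀ w → z ⁻¹ * (z * w) ≈ w
    cancel w = trans (sym (*-assoc (z ⁻¹) z w))
      (trans (*-congʳ (trans (*-comm (z ⁻¹) z) (*-inverse-pos 0<z))) (*-identityˡ w))

  fromℕ-nonneg : ∀ n → 0# ≤ fromℕ n
  fromℕ-nonneg zero    = ≤-refl
  fromℕ-nonneg (suc n) = +-nonneg 0≤1 (fromℕ-nonneg n)

  fromℕ-pos : ∀ n .{{_ : ℕ.NonZero n}} → 0# < fromℕ n
  fromℕ-pos (suc n) = <-≤-trans 0<1 (≤-resp (+-identityʳ 1#) refl (+-monoʳ-≤ 1# (fromℕ-nonneg n)))

  fromℤ : ℤ → Carrier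
  fromℤ (+ n)    = fromℕ n
  fromℤ -[1+ n ] = - fromℕ (suc n)

  fromℕ-+ : ∀ m n → fromℕ (m ℕ.+ n) ≈ fromℕ m + fromℕ n
  fromℕ-+ = M.×-homo-+ 1#

  fromℕ-* : ∀ m n → fromℕ (m ℕ.* n) ≈ fromℕ m * fromℕ n
  fromℕ-* = M.×1-homo-*

  fromℤ-neg : ∀ i → fromℤ (ℤ.- i) ≈ - fromℤ i
  fromℤ-neg (+ zero)  = sym R.-0#≈0#
  fromℤ-neg (+ suc n) = refl
  fromℤ-neg -[1+ n ]  = sym (R.-‿involutive _)

  fromℤ-⊖ : ∀ m n → fromℤ (m ℤ.⊖ n) ≈ fromℕ m - fromℕ n
  fromℤ-⊖ m n with ℕ.≤-total n m
  ... | inj₁ n≤m = trans (reflexive (≡.cong fromℤ (ℤ.⊖-≥ n≤m))) (begin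
    fromℕ (m ℕ.∸ n)                         ≈⟨ +-identityʳ _ ⟨
    fromℕ (m ℕ.∸ n) + 0#                    ≈⟨ +-congˡ (-‿inverseʳ (fromℕ n)) ⟨
    fromℕ (m ℕ.∸ n) + (fromℕ n - fromℕ n)   ≈⟨ +-assoc _ _ _ ⟨
    fromℕ (m ℕ.∸ n) + fromℕ n - fromℕ n     ≈⟨ +-congʳ (fromℕ-+ (m ℕ.∸ n) n) ⟨
    fromℕ (m ℕ.∸ n ℕ.+ n) - fromℕ n         ≡⟨ ≡.cong (λ k → fromℕ k - fromℕ n) (ℕ.m∸n+n≡m n≤m) ⟩
    fromℕ m - fromℕ n                       ∎)
    where open import Relation.Binary.Reasoning.Setoid setoid
  ... | inj₂ m≤n = trans (reflexive (≡.cong fromℤ (ℤ.⊖-≤ m≤n))) (trans (fromℤ-neg (+ (n ℕ.∸ m))) (begin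
    - fromℕ (n ℕ.∸ m)                       ≈⟨ -‿cong (+-identityʳ _) ⟨
    - (fromℕ (n ℕ.∸ m) + 0#)                ≈⟨ -‿cong (+-congˡ (-‿inverseʳ (fromℕ m))) ⟨
    - (fromℕ (n ℕ.∸ m) + (fromℕ m - fromℕ m)) ≈⟨ -‿cong (+-assoc _ _ _) ⟨
    - (fromℕ (n ℕ.∸ m) + fromℕ m - fromℕ m) ≈⟨ -‿cong (+-congʳ (fromℕ-+ (n ℕ.∸ m) m)) ⟨
    - (fromℕ (n ℕ.∸ m ℕ.+ m) - fromℕ m)     ≡⟨ ≡.cong (λ k → - (fromℕ k - fromℕ m)) (ℕ.m∸n+n≡m m≤n) ⟩
    - (fromℕ n - fromℕ m)                   ≈⟨ R.-‿+-comm (fromℕ n) (- fromℕ m) ⟨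
    - fromℕ n - (- fromℕ m)                 ≈⟨ +-comm _ _ ⟩
    - (- fromℕ m) - fromℕ n                 ≈⟨ +-congʳ (R.-‿involutive (fromℕ m)) ⟩
    fromℕ m - fromℕ n                       ∎))
    where open import Relation.Binary.Reasoning.Setoid setoid

  fromℤ-+ : ∀ i j → fromℤ (i ℤ.+ j) ≈ fromℤ i + fromℤ j
  fromℤ-+ (+ m)    (+ n)    = fromℕ-+ m n
  fromℤ-+ (+ m)    -[1+ n ] = fromℤ-⊖ m (suc n)
  fromℤ-+ -[1+ m ] (+ n)    = trans (fromℤ-⊖ n (suc m)) (+-comm _ _)
  fromℤ-+ -[1+ m ] -[1+ n ] = trans
    (-‿cong (trans (reflexive (≡.cong fromℕ (≡.cong suc (≡.sym (ℕ.+-suc m n))))) (fromℕ-+ (suc m) (suc n))))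
    (sym (R.-‿+-comm _ _))

  fromℤ-* : ∀ i j → fromℤ (i ℤ.* j) ≈ fromℤ i * fromℤ j
  fromℤ-* (+ m)    (+ n)    = trans (reflexive (≡.cong fromℤ (≡.sym (ℤ.pos-* m n)))) (fromℕ-* m n)
  fromℤ-* (+ m)    -[1+ n ] = trans (reflexive (≡.cong fromℤ (≡.sym (ℤ.neg-distribʳ-* (+ m) (+ suc n)))))
    (trans (fromℤ-neg (+ m ℤ.* + suc n)) (trans (-‿cong (fromℤ-* (+ m) (+ suc n))) (R.-‿distribʳ-* _ _)))
  fromℤ-* -[1+ m ] (+ n)    = trans (reflexive (≡.cong fromℤ (≡.sym (ℤ.neg-distribˡ-* (+ suc m) (+ n)))))
    (trans (fromℤ-neg (+ suc m ℤ.* + n)) (trans (-‿cong (fromℤ-* (+ suc m) (+ n))) (R.-‿distribˡ-* _ _)))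
  fromℤ-* -[1+ m ] -[1+ n ] = trans (fromℕ-* (suc m) (suc n))
    (sym (trans (sym (R.-‿distribˡ-* _ _)) (trans (-‿cong (sym (R.-‿distribʳ-* _ _))) (R.-‿involutive _))))

  fromℤ-nonneg : ∀ {i} → + 0 ℤ.≤ i → 0# ≤ fromℤ i
  fromℤ-nonneg (ℤ.+≤+ {n = n} _) = fromℕ-nonneg n

  fromℤ-mono : ∀ {i j} → i ℤ.≤ j → fromℤ i ≤ fromℤ j
  fromℤ-mono {i} {j} i≤j = 0≤y-x⇒x≤y
    (≤-resp refl (trans (fromℤ-+ j (ℤ.- i)) (+-congˡ (fromℤ-neg i))) (fromℤ-nonneg (ℤ.i≤j⇒0≤j-i i≤j)))

-- Integer polynomials: arithmetic, substitution and lower bounds.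

-- Horner forms with integer coefficients, outermost variable first.
Poly : ℕ → Set
Poly zero    = ℤ
Poly (suc n) = List (Poly n)

constant : ∀ n → ℤ → Poly n
constant zero    c = c
constant (suc n) c = constant n c ∷ []

variableₚ : ∀ {n} → Fin n → Poly n
variableₚ {suc n} zero    = constant n (+ 0) ∷ constant n (+ 1) ∷ []
variableₚ {suc n} (suc i) = variableₚ i ∷ []

mutual
  add : ∀ n → Poly n → Poly n → Poly n
  add zero    = ℤ._+_
  add (suc n) = addList n

  addList : ∀ n → List (Poly n) → List (Poly n) → List (Poly n)
  addList n []       qs       = qs
  addList n (p ∷ ps) []       = p ∷ ps
  addList n (p ∷ ps) (q ∷ qs) = add n p q ∷ addList n ps qs

mutual
  mul : ∀ n → Poly n → Poly n → Poly n
  mul zero    = ℤ._*_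
  mul (suc n) = mulList n

  scale : ∀ n → Poly n → List (Poly n) → List (Poly n)
  scale n c []       = []
  scale n c (q ∷ qs) = mul n c q ∷ scale n c qs

  mulList : ∀ n → List (Poly n) → List (Poly n) → List (Poly n)
  mulList n []       qs = []
  mulList n (p ∷ ps) qs = addList n (scale n p qs) (constant n (+ 0) ∷ mulList n ps qs)

-- Coefficient lists are never trimmed, so zero has many representations and is recognised
-- coefficient by coefficient.
isZero : ∀ n → Poly n → Bool
isZero zero    c        = isYes (c ℤ.≟ + 0)
isZero (suc n) []       = true
isZero (suc n) (c ∷ cs) = isZero n c ∧ isZero (suc n) cs

-- A lower bound on the unit cube.
lowerBound : ∀ n → Poly n → ℤ
lowerBound zero    c        = c
lowerBound (suc n) []       = + 0
lowerBound (suc n) (c ∷ cs) = lowerBound n c ℤ.+ (+ 0 ℤ.⊓ lowerBound (suc n) cs)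

-- s ^ (length ps - 1) · p (x / s)
dilate : ∀ n → ℕ → List (Poly n) → List (Poly n)
dilate n s []       = []
dilate n s (p ∷ ps) = mul n (constant n (+ (s ℕ.^ List.length ps))) p ∷ dilate n s ps

-- p (l + x)
translate : ∀ n → ℕ → List (Poly n) → List (Poly n)
translate n l []       = []
translate n l (p ∷ ps) =
  addList n (p ∷ []) (mulList n (constant n (+ l) ∷ constant n (+ 1) ∷ []) (translate n l ps))

-- The unit interval is mapped to [ l / s , (l + 1) / s ].
zoom : ∀ n → (s l : ℕ) → List (Poly n) → List (Poly n)
zoom n s l ps = translate n l (dilate n s ps)

-- Exchanges the two outermost variables, because `nonneg?` subdivides the outermost one.
swap : ∀ n → Poly (suc (suc n)) → Poly (suc (suc n))
swap n []       = []
swap n (p ∷ ps) = addList (suc n) (List.map (_∷ []) p) (List.map (constant n (+ 0) ∷_) (swap n ps))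

-- `d` is the remaining depth of bisection. Both halves of the interval are stretched back to the
-- unit interval. Only the answer `true` is conclusive.
nonneg? : ∀ n → ℕ → List (Poly n) → Bool
nonneg? n zero    ps = isYes (+ 0 ℤ.≤? lowerBound (suc n) ps)
nonneg? n (suc d) ps = isYes (+ 0 ℤ.≤? lowerBound (suc n) ps)
                     ∨ nonneg? n d (zoom n 2 0 ps) ∧ nonneg? n d (zoom n 2 1 ps)

-- Reflected ring expressions.

infixl 6 _:+_ _:-_
infixl 7 _:*_
infix  8 :-_
infixr 8 _:^_
infix  4 _:=_

-- `one` is separate from `con 1` because `fromℕ 1` unfolds to `1# + 0#`, not to `1#`.
data Expr (n : ℕ) : Set where
  one       : Expr n
  con       : ℕ → Expr n
  var       : Fin n → Expr n
  _:+_ _:*_ : Expr n → Expr n → Expr n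
  :-_       : Expr n → Expr n

_:-_ : ∀ {n} → Expr n → Expr n → Expr n
a :- b = a :+ :- b

_:^_ : ∀ {n} → Expr n → ℕ → Expr n
a :^ zero  = one
a :^ suc k = a :* a :^ k

_:=_ : ∀ {n} → Expr n → Expr n → Expr n × Expr n
_:=_ = _,_

normalise : ∀ {n} → Expr n → Poly n
normalise {n} one      = constant n (+ 1)
normalise {n} (con k)  = constant n (+ k)
normalise     (var i)  = variableₚ i
normalise {n} (a :+ b) = add n (normalise a) (normalise b)
normalise {n} (a :* b) = mul n (normalise a) (normalise b)
normalise {n} (:- a)   = mul n (constant n -[1+ 0 ]) (normalise a)

-- Soundness of the identity test and of the nonnegativity test.

module Polynomial (ℝ : CompleteOrderedField) where

  open CompleteOrderedField ℝ
  open OrderedField ℝ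
  private
    module R = RingProperties ring
    module A = CommutativeSemigroupProperties +-commutativeSemigroup
    module X = CommutativeSemigroupProperties *-commutativeSemigroup
  open import Relation.Binary.Reasoning.Setoid setoid

  eval : ∀ n → Poly n → Vec Carrier n → Carrier
  eval zero    c        []      = fromℤ c
  eval (suc n) []       (x ∷ ρ) = 0#
  eval (suc n) (c ∷ cs) (x ∷ ρ) = eval n c ρ + x * eval (suc n) cs (x ∷ ρ)

  ⟦_⟧ : ∀ {n} → Expr n → Vec Carrier n → Carrier
  ⟦ one    ⟧ ρ = 1#
  ⟦ con k  ⟧ ρ = fromℕ k
  ⟦ var i  ⟧ ρ = lookup ρ i
  ⟦ a :+ b ⟧ ρ = ⟦ a ⟧ ρ + ⟦ b ⟧ ρ
  ⟦ a :* b ⟧ ρ = ⟦ a ⟧ ρ * ⟦ b ⟧ ρ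
  ⟦ :- a   ⟧ ρ = - ⟦ a ⟧ ρ

  eval-constant : ∀ n c ρ → eval n (constant n c) ρ ≈ fromℤ c
  eval-constant zero    c []      = refl
  eval-constant (suc n) c (x ∷ ρ) =
    trans (+-cong (eval-constant n c ρ) (zeroʳ x)) (+-identityʳ _)

  fromℕ-1 : fromℕ 1 ≈ 1#
  fromℕ-1 = +-identityʳ 1#

  eval-variable : ∀ {n} (i : Fin n) ρ → eval n (variableₚ i) ρ ≈ lookup ρ i
  eval-variable {suc n} zero (x ∷ ρ) = begin
    eval n (constant n (+ 0)) ρ + x * (eval n (constant n (+ 1)) ρ + x * 0#)
      ≈⟨ +-cong (eval-constant n (+ 0) ρ) (*-congˡ (+-cong (eval-constant n (+ 1) ρ) (zeroʳ x))) ⟩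
    0# + x * (fromℕ 1 + 0#)
      ≈⟨ +-identityˡ _ ⟩
    x * (fromℕ 1 + 0#)
      ≈⟨ *-congˡ (trans (+-identityʳ _) fromℕ-1) ⟩
    x * 1#
      ≈⟨ *-identityʳ x ⟩
    x ∎
  eval-variable {suc n} (suc i) (x ∷ ρ) =
    trans (+-cong (eval-variable i ρ) (zeroʳ x)) (+-identityʳ _)

  mutual
    eval-add : ∀ n p q ρ → eval n (add n p q) ρ ≈ eval n p ρ + eval n q ρ
    eval-add zero    p q []      = fromℤ-+ p q
    eval-add (suc n) p q (x ∷ ρ) = eval-addList n p q x ρ

    eval-addList : ∀ n ps qs x ρ →
      eval (suc n) (addList n ps qs) (x ∷ ρ) ≈ eval (suc n) ps (x ∷ ρ) + eval (suc n) qs (x ∷ ρ)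
    eval-addList n []       qs       x ρ = sym (+-identityˡ _)
    eval-addList n (p ∷ ps) []       x ρ = sym (+-identityʳ _)
    eval-addList n (p ∷ ps) (q ∷ qs) x ρ = begin
      eval n (add n p q) ρ + x * eval (suc n) (addList n ps qs) (x ∷ ρ)
        ≈⟨ +-cong (eval-add n p q ρ) (*-congˡ (eval-addList n ps qs x ρ)) ⟩
      eval n p ρ + eval n q ρ + x * (eval (suc n) ps (x ∷ ρ) + eval (suc n) qs (x ∷ ρ))
        ≈⟨ +-congˡ (distribˡ x _ _) ⟩
      eval n p ρ + eval n q ρ + (x * eval (suc n) ps (x ∷ ρ) + x * eval (suc n) qs (x ∷ ρ))
        ≈⟨ A.interchange _ _ _ _ ⟩
      eval (suc n) (p ∷ ps) (x ∷ ρ) + eval (suc n) (q ∷ qs) (x ∷ ρ) ∎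

  mutual
    eval-mul : ∀ n p q ρ → eval n (mul n p q) ρ ≈ eval n p ρ * eval n q ρ
    eval-mul zero    p q []      = fromℤ-* p q
    eval-mul (suc n) p q (x ∷ ρ) = eval-mulList n p q x ρ

    eval-scale : ∀ n c qs x ρ →
      eval (suc n) (scale n c qs) (x ∷ ρ) ≈ eval n c ρ * eval (suc n) qs (x ∷ ρ)
    eval-scale n c []       x ρ = sym (zeroʳ _)
    eval-scale n c (q ∷ qs) x ρ = begin
      eval n (mul n c q) ρ + x * eval (suc n) (scale n c qs) (x ∷ ρ)
        ≈⟨ +-cong (eval-mul n c q ρ) (trans (*-congˡ (eval-scale n c qs x ρ)) (X.x∙yz≈y∙xz _ _ _)) ⟩
      eval n c ρ * eval n q ρ + eval n c ρ * (x * eval (suc n) qs (x ∷ ρ))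
        ≈⟨ distribˡ _ _ _ ⟨
      eval n c ρ * eval (suc n) (q ∷ qs) (x ∷ ρ) ∎

    eval-mulList : ∀ n ps qs x ρ →
      eval (suc n) (mulList n ps qs) (x ∷ ρ) ≈ eval (suc n) ps (x ∷ ρ) * eval (suc n) qs (x ∷ ρ)
    eval-mulList n []       qs x ρ = sym (zeroˡ _)
    eval-mulList n (p ∷ ps) qs x ρ = begin
      eval (suc n) (addList n (scale n p qs) (constant n (+ 0) ∷ mulList n ps qs)) (x ∷ ρ)
        ≈⟨ eval-addList n (scale n p qs) _ x ρ ⟩
      eval (suc n) (scale n p qs) (x ∷ ρ)
        + (eval n (constant n (+ 0)) ρ + x * eval (suc n) (mulList n ps qs) (x ∷ ρ))
        ≈⟨ +-cong (eval-scale n p qs x ρ)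
             (trans (+-cong (eval-constant n (+ 0) ρ) (*-congˡ (eval-mulList n ps qs x ρ)))
               (trans (+-identityˡ _) (sym (*-assoc _ _ _)))) ⟩
      eval n p ρ * eval (suc n) qs (x ∷ ρ) + x * eval (suc n) ps (x ∷ ρ) * eval (suc n) qs (x ∷ ρ)
        ≈⟨ distribʳ _ _ _ ⟨
      eval (suc n) (p ∷ ps) (x ∷ ρ) * eval (suc n) qs (x ∷ ρ) ∎

  normalise-correct : ∀ {n} (e : Expr n) ρ → eval n (normalise e) ρ ≈ ⟦ e ⟧ ρ
  normalise-correct {n} one      ρ = trans (eval-constant n (+ 1) ρ) fromℕ-1
  normalise-correct {n} (con k)  ρ = eval-constant n (+ k) ρ
  normalise-correct     (var i)  ρ = eval-variable i ρ
  normalise-correct {n} (a :+ b) ρ =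
    trans (eval-add n (normalise a) (normalise b) ρ) (+-cong (normalise-correct a ρ) (normalise-correct b ρ))
  normalise-correct {n} (a :* b) ρ =
    trans (eval-mul n (normalise a) (normalise b) ρ) (*-cong (normalise-correct a ρ) (normalise-correct b ρ))
  normalise-correct {n} (:- a)   ρ = begin
    eval n (mul n (constant n -[1+ 0 ]) (normalise a)) ρ  ≈⟨ eval-mul n _ (normalise a) ρ ⟩
    eval n (constant n -[1+ 0 ]) ρ * eval n (normalise a) ρ
      ≈⟨ *-cong (trans (eval-constant n _ ρ) (-‿cong fromℕ-1)) (normalise-correct a ρ) ⟩
    - 1# * ⟦ a ⟧ ρ                                        ≈⟨ R.-1*x≈-x _ ⟩
    - ⟦ a ⟧ ρ                                             ∎

  ∧-true : ∀ {a b} → a ∧ b ≡ true → a ≡ true × b ≡ true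
  ∧-true {true} {true} _ = ≡.refl , ≡.refl

  isYes-true : ∀ {A : Set} (a? : Dec A) → isYes a? ≡ true → A
  isYes-true (yes a) _ = a

  isZero-sound : ∀ n p ρ → isZero n p ≡ true → eval n p ρ ≈ 0#
  isZero-sound zero    c        []      c≡0 = reflexive (≡.cong fromℤ (isYes-true (c ℤ.≟ + 0) c≡0))
  isZero-sound (suc n) []       (x ∷ ρ) _   = refl
  isZero-sound (suc n) (c ∷ cs) (x ∷ ρ) eq with ∧-true eq
  ... | c≡0 , cs≡0 = trans
    (+-cong (isZero-sound n c ρ c≡0) (trans (*-congˡ (isZero-sound (suc n) cs (x ∷ ρ) cs≡0)) (zeroʳ x)))
    (+-identityˡ 0#)

  close : ∀ {A : Set} n → N-ary n (Expr n) A → A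
  close n f = f $ⁿ Vec.map var (allFin n)

  -- The premise is a closed boolean computation, so a valid identity is discharged by `≡.refl`.
  prove : ∀ {n} (l r : Expr n) → isZero n (normalise (l :- r)) ≡ true → ∀ ρ → ⟦ l ⟧ ρ ≈ ⟦ r ⟧ ρ
  prove {n} l r eq ρ = R.x∙y⁻¹≈ε⇒x≈y _ _
    (trans (sym (normalise-correct (l :- r) ρ)) (isZero-sound n (normalise (l :- r)) ρ eq))

  solve : ∀ n (f : N-ary n (Expr n) (Expr n × Expr n)) →
    isZero n (normalise (proj₁ (close n f) :- proj₂ (close n f))) ≡ true →
    Eq n _≈_ (curryⁿ ⟦ proj₁ (close n f) ⟧) (curryⁿ ⟦ proj₂ (close n f) ⟧)
  solve n f eq = curryⁿ-cong _≈_ ⟦ proj₁ (close n f) ⟧ ⟦ proj₂ (close n f) ⟧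
    (prove (proj₁ (close n f)) (proj₂ (close n f)) eq)

  Unit : Carrier → Set
  Unit x = 0# ≤ x × x ≤ 1#

  -- For `b ≤ e` and `0 ≤ x ≤ 1`, the product `x * e` is at least `0` if `b` is nonnegative, and at
  -- least `x * b ≥ b` otherwise.
  lowerBound-sound : ∀ n p {ρ} → VecAll.All Unit ρ → fromℤ (lowerBound n p) ≤ eval n p ρ
  lowerBound-sound zero    c        []                = ≤-refl
  lowerBound-sound (suc n) []       (_ ∷ _)           = ≤-refl
  lowerBound-sound (suc n) (c ∷ cs) (_∷_ {x = x} {xs = ρ} (0≤x , x≤1) us) =
    ≤-trans (≤-reflexive (fromℤ-+ (lowerBound n c) (+ 0 ℤ.⊓ b)))
      (+-mono-≤ (lowerBound-sound n c us) 0⊓b≤xe)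
    where
    b = lowerBound (suc n) cs
    e = eval (suc n) cs (x ∷ ρ)
    b≤e : fromℤ b ≤ e
    b≤e = lowerBound-sound (suc n) cs ((0≤x , x≤1) ∷ us)
    0⊓b≤xe : fromℤ (+ 0 ℤ.⊓ b) ≤ x * e
    0⊓b≤xe with ℤ.≤-total (+ 0) b
    ... | inj₁ 0≤b = ≤-trans (fromℤ-mono (ℤ.i⊓j≤i (+ 0) b)) (*-nonneg 0≤x (≤-trans (fromℤ-nonneg 0≤b) b≤e))
    ... | inj₂ b≤0 = ≤-trans (fromℤ-mono (ℤ.i⊓j≤j (+ 0) b)) (≤-trans
      (0≤y-x⇒x≤y (≤-resp refl
        (solve 2 (λ x b → (one :- x) :* (:- b) := x :* b :- b) ≡.refl x (fromℤ b))
        (*-nonneg (x≤y⇒0≤y-x x≤1) (x≤0⇒0≤-x (fromℤ-mono b≤0)))))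
      (*-monoˡ-≤ 0≤x b≤e))

  -- `dilate` multiplies the value by `s ^ (length ps - 1)`; the additional factor `fromℕ s` avoids
  -- the subtraction and also covers the empty list.
  eval-dilate : ∀ n s ps x ρ →
    fromℕ s * eval (suc n) (dilate n s ps) (fromℕ s * x ∷ ρ)
      ≈ fromℕ (s ℕ.^ List.length ps) * eval (suc n) ps (x ∷ ρ)
  eval-dilate n s []       x ρ = trans (zeroʳ _) (sym (zeroʳ _))
  eval-dilate n s (p ∷ ps) x ρ = begin
    fromℕ s * (eval n (mul n (constant n (+ k)) p) ρ + fromℕ s * x * d)
      ≈⟨ *-congˡ (+-congʳ (trans (eval-mul n _ p ρ) (*-congʳ (eval-constant n (+ k) ρ)))) ⟩
    fromℕ s * (fromℕ k * eval n p ρ + fromℕ s * x * d)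
      ≈⟨ solve 5 (λ s k e x d → s :* (k :* e :+ s :* x :* d) := s :* k :* e :+ s :* x :* (s :* d)) ≡.refl _ _ _ _ _ ⟩
    fromℕ s * fromℕ k * eval n p ρ + fromℕ s * x * (fromℕ s * d)
      ≈⟨ +-congˡ (*-congˡ (eval-dilate n s ps x ρ)) ⟩
    fromℕ s * fromℕ k * eval n p ρ + fromℕ s * x * (fromℕ k * eval (suc n) ps (x ∷ ρ))
      ≈⟨ solve 5 (λ s k e x d → s :* k :* e :+ s :* x :* (k :* d) := s :* k :* (e :+ x :* d)) ≡.refl _ _ _ _ _ ⟩
    fromℕ s * fromℕ k * (eval n p ρ + x * eval (suc n) ps (x ∷ ρ))
      ≈⟨ *-congʳ (fromℕ-* s k) ⟨
    fromℕ (s ℕ.* k) * (eval n p ρ + x * eval (suc n) ps (x ∷ ρ)) ∎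
    where
    k = s ℕ.^ List.length ps
    d = eval (suc n) (dilate n s ps) (fromℕ s * x ∷ ρ)

  eval-translate : ∀ n l ps x ρ →
    eval (suc n) (translate n l ps) (x ∷ ρ) ≈ eval (suc n) ps (fromℕ l + x ∷ ρ)
  eval-translate n l []       x ρ = refl
  eval-translate n l (p ∷ ps) x ρ = begin
    eval (suc n) (addList n (p ∷ []) (mulList n (constant n (+ l) ∷ constant n (+ 1) ∷ []) (translate n l ps))) (x ∷ ρ)
      ≈⟨ eval-addList n (p ∷ []) (mulList n (constant n (+ l) ∷ constant n (+ 1) ∷ []) (translate n l ps)) x ρ ⟩
    eval n p ρ + x * 0# + eval (suc n) (mulList n (constant n (+ l) ∷ constant n (+ 1) ∷ []) (translate n l ps)) (x ∷ ρ)
      ≈⟨ +-congˡ (trans (eval-mulList n (constant n (+ l) ∷ constant n (+ 1) ∷ []) (translate n l ps) x ρ)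
           (*-cong (+-cong (eval-constant n (+ l) ρ) (*-congˡ (+-congʳ (trans (eval-constant n (+ 1) ρ) fromℕ-1))))
             (eval-translate n l ps x ρ))) ⟩
    eval n p ρ + x * 0# + (fromℕ l + x * (1# + x * 0#)) * eval (suc n) ps (fromℕ l + x ∷ ρ)
      ≈⟨ solve 4 (λ p x l e → p :+ x :* con 0 :+ (l :+ x :* (one :+ x :* con 0)) :* e := p :+ (l :+ x) :* e)
           ≡.refl _ _ _ _ ⟩
    eval n p ρ + (fromℕ l + x) * eval (suc n) ps (fromℕ l + x ∷ ρ) ∎

  eval-congˡ : ∀ n ps {x y} ρ → x ≈ y → eval (suc n) ps (x ∷ ρ) ≈ eval (suc n) ps (y ∷ ρ)
  eval-congˡ n []       ρ x≈y = refl
  eval-congˡ n (p ∷ ps) ρ x≈y = +-congˡ (*-cong x≈y (eval-congˡ n ps ρ x≈y))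

  -- After multiplication by `fromℕ s`, the zoomed value is the original one times a positive power
  -- of `s`, which can be cancelled.
  zoom-nonneg : ∀ n s l ps x ρ .{{_ : ℕ.NonZero s}} →
    0# ≤ eval (suc n) (zoom n s l ps) (fromℕ s * x - fromℕ l ∷ ρ) →
    0# ≤ eval (suc n) ps (x ∷ ρ)
  zoom-nonneg n s l ps x ρ 0≤z = *-cancelˡ-≤ (fromℕ-pos (s ℕ.^ List.length ps))
    (≤-resp (sym (zeroʳ _)) eq (*-nonneg (fromℕ-nonneg s) 0≤z))
    where
    instance _ = ℕ.m^n≢0 s (List.length ps)
    eq : fromℕ s * eval (suc n) (zoom n s l ps) (fromℕ s * x - fromℕ l ∷ ρ)
       ≈ fromℕ (s ℕ.^ List.length ps) * eval (suc n) ps (x ∷ ρ)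
    eq = trans (*-congˡ (trans (eval-translate n l (dilate n s ps) _ ρ)
                 (eval-congˡ n (dilate n s ps) ρ
                   (solve 2 (λ a b → b :+ (a :- b) := a) ≡.refl (fromℕ s * x) (fromℕ l)))))
           (eval-dilate n s ps x ρ)

  eval-map-constant : ∀ n ps x y ρ →
    eval (suc (suc n)) (List.map (_∷ []) ps) (y ∷ x ∷ ρ) ≈ eval (suc n) ps (y ∷ ρ)
  eval-map-constant n []       x y ρ = refl
  eval-map-constant n (p ∷ ps) x y ρ =
    +-cong (trans (+-congˡ (zeroʳ x)) (+-identityʳ _)) (*-congˡ (eval-map-constant n ps x y ρ))

  eval-map-shift : ∀ n ps x y ρ →
    eval (suc (suc n)) (List.map (constant n (+ 0) ∷_) ps) (y ∷ x ∷ ρ) ≈ x * eval (suc (suc n)) ps (y ∷ x ∷ ρ)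
  eval-map-shift n []       x y ρ = sym (zeroʳ x)
  eval-map-shift n (p ∷ ps) x y ρ = trans
    (+-cong (+-congʳ (eval-constant n (+ 0) ρ)) (*-congˡ (eval-map-shift n ps x y ρ)))
    (solve 4 (λ x y e f → con 0 :+ x :* e :+ y :* (x :* f) := x :* (e :+ y :* f)) ≡.refl _ _ _ _)

  eval-swap : ∀ n ps x y ρ → eval (suc (suc n)) (swap n ps) (y ∷ x ∷ ρ) ≈ eval (suc (suc n)) ps (x ∷ y ∷ ρ)
  eval-swap n []       x y ρ = refl
  eval-swap n (p ∷ ps) x y ρ = trans
    (eval-addList (suc n) (List.map (_∷ []) p) _ y (x ∷ ρ))
    (+-cong (eval-map-constant n p x y ρ)
      (trans (eval-map-shift n (swap n ps) x y ρ) (*-congˡ (eval-swap n ps x y ρ))))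

  lowerBound-nonneg : ∀ n ps {ρ} → isYes (+ 0 ℤ.≤? lowerBound (suc n) ps) ≡ true →
    VecAll.All Unit ρ → 0# ≤ eval (suc n) ps ρ
  lowerBound-nonneg n ps eq us =
    ≤-trans (fromℤ-nonneg (isYes-true (+ 0 ℤ.≤? lowerBound (suc n) ps) eq)) (lowerBound-sound (suc n) ps us)

  nonneg?-sound : ∀ n d ps {ρ} → nonneg? n d ps ≡ true → VecAll.All Unit ρ → 0# ≤ eval (suc n) ps ρ
  nonneg?-sound n zero    ps eq us = lowerBound-nonneg n ps eq us
  nonneg?-sound n (suc d) ps eq us with isYes (+ 0 ℤ.≤? lowerBound (suc n) ps) in eq′
  ... | true = lowerBound-nonneg n ps eq′ us
  nonneg?-sound n (suc d) ps {x ∷ ρ} eq ((0≤x , x≤1) ∷ us) | false with ∧-true eq | ≤-total (fromℕ 2 * x) 1#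
  ... | eqˡ , _ | inj₁ 2x≤1 = zoom-nonneg n 2 0 ps x ρ
    (nonneg?-sound n d (zoom n 2 0 ps) eqˡ
      (( ≤-resp refl (solve 1 (λ x → con 2 :* x := con 2 :* x :- con 0) ≡.refl x) (*-nonneg (fromℕ-nonneg 2) 0≤x)
       , ≤-resp (solve 1 (λ x → con 2 :* x := con 2 :* x :- con 0) ≡.refl x) refl 2x≤1) ∷ us))
  ... | _ , eqʳ | inj₂ 1≤2x = zoom-nonneg n 2 1 ps x ρ
    (nonneg?-sound n d (zoom n 2 1 ps) eqʳ
      (( ≤-resp refl (+-congˡ (-‿cong (sym fromℕ-1))) (x≤y⇒0≤y-x 1≤2x)
       , 0≤y-x⇒x≤y (≤-resp refl (solve 1 (λ x → con 2 :* (one :- x) := one :- (con 2 :* x :- con 1)) ≡.refl x)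
           (*-nonneg (fromℕ-nonneg 2) (x≤y⇒0≤y-x x≤1)))) ∷ us))

  -- The first variable is confined to a narrow interval, so only the second is bisected.
  prove-nonneg : ∀ (s l d : ℕ) .{{_ : ℕ.NonZero s}} (e : Expr 2) →
    nonneg? 1 d (swap 0 (zoom 1 s l (normalise e))) ≡ true →
    ∀ {t p} → fromℕ l ≤ fromℕ s * t → fromℕ s * t ≤ fromℕ (suc l) → Unit p →
    0# ≤ ⟦ e ⟧ (t ∷ p ∷ [])
  prove-nonneg s l d e eq {t} {p} l≤st st≤l+1 0≤p≤1 = ≤-resp refl (normalise-correct e _)
    (zoom-nonneg 1 s l (normalise e) t (p ∷ []) (≤-resp refl (eval-swap 0 z _ p [])
      (nonneg?-sound 1 d (swap 0 z) eq (0≤p≤1 ∷ (x≤y⇒0≤y-x l≤st , τ≤1) ∷ []))))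
    where
    z = zoom 1 s l (normalise e)
    τ≤1 : fromℕ s * t - fromℕ l ≤ 1#
    τ≤1 = ≤-resp refl (solve 1 (λ l → one :+ l :- l := one) ≡.refl (fromℕ l)) (+-monoˡ-≤ (- fromℕ l) st≤l+1)

-- The Archimedean property, and suprema and infima in [0,∞].

module ExtendedReals (em : ExcludedMiddle 0ℓ) (ℝ : CompleteOrderedField) where

  open CompleteOrderedField ℝ
  open OrderedField ℝ
  open Polynomial ℝ using (solve)
  open Rendezvous em ℝ

  -- If `σ` were the least upper bound of the naturals, then `n + 1 ≤ σ` for all `n` would make
  -- `σ - 1` an upper bound as well.
  archimedean : ∀ {x} → ¬ (∀ n → fromℕ n ≤ x)
  archimedean {x} bounded with complete (λ y → ∃ λ n → y ≈ fromℕ n)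
      (fromℕ 0 , 0 , refl) (x , λ _ (n , y≈n) → ≤-trans (≤-reflexive y≈n) (bounded n))
  ... | σ , ub , least = 0≉1 (≤-antisym 0≤1 (≤-resp
      (solve 1 (λ s → s :- s :+ one := one) ≡.refl σ) (solve 1 (λ s → s :- one :- s :+ one := con 0) ≡.refl σ)
      (+-monoˡ-≤ 1# (+-monoˡ-≤ (- σ) (least (σ - 1#) λ y (n , y≈n) → ≤-resp
        (trans (solve 1 (λ n → one :+ n :- one := n) ≡.refl (fromℕ n)) (sym y≈n)) refl
        (+-monoˡ-≤ (- 1#) (ub _ (suc n , refl))))))))

  -- For positive `y` the number `x * y ⁻¹` would bound all naturals.
  archimedean-nonpos : ∀ {x y} → (∀ n → fromℕ n * y ≤ x) → y ≤ 0#
  archimedean-nonpos {x} {y} bounded with em {y ≤ 0#}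
  ... | yes y≤0 = y≤0
  ... | no  y≰0 = contradiction
    (λ n → ≤-resp
      (trans (*-assoc _ _ _) (trans (*-congˡ (*-inverse-pos (≰⇒> y≰0))) (*-identityʳ _))) refl
      (*-monoʳ-≤ (⁻¹-pos (≰⇒> y≰0)) (bounded n)))
    archimedean

  -- Exposes the case distinction inside `sup∞`. Competing bounds `v` have to be nonnegative because
  -- `0#` is adjoined to the set.
  sup∞-cases : ∀ P →
    (∃ λ σ → sup∞ P ≡ fin σ × 0# ≤ σ × UpperBound P σ × (∀ v → 0# ≤ v → UpperBound P v → σ ≤ v)) ⊎
    (sup∞ P ≡ ∞ × (∀ v → 0# ≤ v → ¬ UpperBound P v))
  sup∞-cases P with em {∃ (UpperBound (λ x → x ≈ 0# ⊎ P x))}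
  ... | no unbounded = inj₂ (≡.refl , λ v 0≤v ub → unbounded
    (v , λ { x (inj₁ x≈0) → ≤-trans (≤-reflexive x≈0) 0≤v ; x (inj₂ Px) → ub x Px }))
  ... | yes bounded with complete _ (0# , inj₁ refl) bounded
  ...   | σ , ub , least = inj₁ (σ , ≡.refl , ub 0# (inj₁ refl) , (λ x Px → ub x (inj₂ Px)) , λ v 0≤v ub′ → least v
    λ { x (inj₁ x≈0) → ≤-trans (≤-reflexive x≈0) 0≤v ; x (inj₂ Px) → ub′ x Px })

  sup∞-bounded : ∀ P {b} → 0# ≤ b → UpperBound P b →
    ∃ λ σ → sup∞ P ≡ fin σ × 0# ≤ σ × UpperBound P σ × (∀ v → 0# ≤ v → UpperBound P v → σ ≤ v)
  sup∞-bounded P 0≤b ub with sup∞-cases P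
  ... | inj₁ s                = s
  ... | inj₂ (_ , unbounded) = contradiction ub (unbounded _ 0≤b)

  -- `inf∞ Q` is the supremum of the lower bounds of `Q`. Here `x` is one of them, and as a member
  -- of `Q` it bounds them all.
  inf∞-attained : ∀ Q {x} → 0# ≤ x → (∀ y → Q y → fin x ≤∞ y) → Q (fin x) → inf∞ Q ≈∞ fin x
  inf∞-attained Q {x} 0≤x lower Qx with sup∞-bounded (λ z → ∀ y → Q y → fin z ≤∞ y) 0≤x (λ z lb → lb (fin x) Qx)
  ... | σ , eq , _ , ub , least rewrite eq = ≤-antisym (least x 0≤x (λ z lb → lb (fin x) Qx)) (ub x lower)

  ≈∞-sym : ∀ x y → x ≈∞ y → y ≈∞ x
  ≈∞-sym (fin x) (fin y) x≈y = sym x≈y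
  ≈∞-sym ∞       ∞       _   = tt

  ≈∞-join : ∀ x y z → x ≈∞ z → y ≈∞ z → x ≈∞ y
  ≈∞-join (fin x) (fin y) (fin z) x≈z y≈z = trans x≈z (sym y≈z)
  ≈∞-join ∞       ∞       ∞       _   _   = tt

  ≤∞-respʳ : ∀ x y z → y ≈∞ z → x ≤∞ z → x ≤∞ y
  ≤∞-respʳ (fin x) (fin y) (fin z) y≈z x≤z = ≤-trans x≤z (≤-reflexive (sym y≈z))
  ≤∞-respʳ _       ∞       ∞       _   _   = tt

  -- Expectations over finite weighted lists.

  module Expectation where

    expect : ∀ {A : Set} → Dist A → (A → Carrier) → Carrier
    expect μ f = ∑ (List.map (λ (p , x) → p * f x) μ)

    expect-cong : ∀ {A} (μ : Dist A) {f g} → (∀ x → f x ≈ g x) → expect μ f ≈ expect μ g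
    expect-cong []            f≈g = refl
    expect-cong ((p , x) ∷ μ) f≈g = +-cong (*-congˡ (f≈g x)) (expect-cong μ f≈g)

    expect-++ : ∀ {A} (μ ν : Dist A) f → expect (μ ++ ν) f ≈ expect μ f + expect ν f
    expect-++ []            ν f = sym (+-identityˡ _)
    expect-++ ((p , x) ∷ μ) ν f = trans (+-congˡ (expect-++ μ ν f)) (sym (+-assoc _ _ _))

    expect-weight : ∀ {A} p (μ : Dist A) f →
      expect (List.map (λ (q , y) → (p * q , y)) μ) f ≈ p * expect μ f
    expect-weight p []            f = sym (zeroʳ p)
    expect-weight p ((q , y) ∷ μ) f =
      trans (+-cong (*-assoc p q (f y)) (expect-weight p μ f)) (sym (distribˡ p _ _))

    expect->>= : ∀ {A B} (μ : Dist A) (κ : A → Dist B) f →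
      expect (μ >>= κ) f ≈ expect μ (λ x → expect (κ x) f)
    expect->>= []            κ f = refl
    expect->>= ((p , x) ∷ μ) κ f =
      trans (expect-++ (List.map (λ (q , y) → (p * q , y)) (κ x)) (μ >>= κ) f)
        (+-cong (expect-weight p (κ x) f) (expect->>= μ κ f))

    expect-mapDist : ∀ {A B : Set} (h : A → B) (μ : Dist A) f → expect (mapDist h μ) f ≈ expect μ (f ∘ h)
    expect-mapDist h []            f = refl
    expect-mapDist h ((p , x) ∷ μ) f = +-congˡ (expect-mapDist h μ f)

    expect-zero : ∀ {A} (μ : Dist A) → expect μ (λ _ → 0#) ≈ 0#
    expect-zero []            = refl
    expect-zero ((p , x) ∷ μ) = trans (+-cong (zeroʳ p) (expect-zero μ)) (+-identityˡ 0#)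

    expect-+ : ∀ {A} (μ : Dist A) f g → expect μ (λ x → f x + g x) ≈ expect μ f + expect μ g
    expect-+ []            f g = sym (+-identityˡ 0#)
    expect-+ ((p , x) ∷ μ) f g = trans (+-congˡ (expect-+ μ f g))
      (solve 5 (λ p a b c d → p :* (a :+ b) :+ (c :+ d) := p :* a :+ c :+ (p :* b :+ d)) ≡.refl _ _ _ _ _)

    expect-* : ∀ {A} (μ : Dist A) c f → expect μ (λ x → c * f x) ≈ c * expect μ f
    expect-* []            c f = sym (zeroʳ c)
    expect-* ((p , x) ∷ μ) c f = trans (+-congˡ (expect-* μ c f))
      (solve 4 (λ p c a b → p :* (c :* a) :+ c :* b := c :* (p :* a :+ b)) ≡.refl _ _ _ _)

    expect-- : ∀ {A} (μ : Dist A) f → expect μ (λ x → 1# - f x) ≈ expect μ (λ _ → 1#) - expect μ f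
    expect-- []            f = sym (-‿inverseʳ 0#)
    expect-- ((p , x) ∷ μ) f = trans (+-congˡ (expect-- μ f))
      (solve 4 (λ p a b c → p :* (one :- a) :+ (b :- c) := p :* one :+ b :- (p :* a :+ c)) ≡.refl _ _ _ _)

    expect-∑ : ∀ {A} (μ : Dist A) (f : ℕ → A → Carrier) N →
      ∑ (applyUpTo (λ t → expect μ (f t)) N) ≈ expect μ (λ x → ∑ (applyUpTo (λ t → f t x) N))
    expect-∑ μ f zero    = sym (expect-zero μ)
    expect-∑ μ f (suc N) = trans (+-congˡ (expect-∑ μ (f ∘ suc) N)) (sym (expect-+ μ (f 0) _))

    -- Outcomes of weight zero are exempt from `f x ≤ g x`, so the comparison can be restricted to
    -- states that are really reached.
    expect-mono : ∀ {A} {μ : Dist A} {f g} →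
      All (λ (p , x) → 0# ≤ p × (p ≈ 0# ⊎ f x ≤ g x)) μ → expect μ f ≤ expect μ g
    expect-mono []                             = ≤-refl
    expect-mono ((_   , inj₁ p≈0) ∷ rest) = +-mono-≤
      (≤-reflexive (trans (*-congʳ p≈0) (trans (zeroˡ _) (sym (trans (*-congʳ p≈0) (zeroˡ _)))))) (expect-mono rest)
    expect-mono ((0≤p , inj₂ f≤g) ∷ rest) = +-mono-≤ (*-monoˡ-≤ 0≤p f≤g) (expect-mono rest)

    indicator : Bool → Carrier
    indicator b = if b then 1# else 0#

    prob-expect : ∀ {A} {P : A → Set} (μ : Dist A) (P? : Decidable P) →
      prob μ P? ≈ expect μ (λ x → indicator (does (P? x)))
    prob-expect []            P? = refl
    prob-expect ((p , x) ∷ μ) P? with does (P? x)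
    ... | true  = +-cong (sym (*-identityʳ p)) (prob-expect μ P?)
    ... | false = trans (prob-expect μ P?) (sym (trans (+-congʳ (zeroʳ p)) (+-identityˡ _)))

  open Expectation

  ∑-cong : ∀ {f g : ℕ → Carrier} → (∀ t → f t ≈ g t) → ∀ N → ∑ (applyUpTo f N) ≈ ∑ (applyUpTo g N)
  ∑-cong f≈g zero    = refl
  ∑-cong f≈g (suc N) = +-cong (f≈g 0) (∑-cong (f≈g ∘ suc) N)

  ∑-+ : ∀ (f g : ℕ → Carrier) N →
    ∑ (applyUpTo (λ t → f t + g t) N) ≈ ∑ (applyUpTo f N) + ∑ (applyUpTo g N)
  ∑-+ f g zero    = sym (+-identityˡ 0#)
  ∑-+ f g (suc N) = trans (+-congˡ (∑-+ (f ∘ suc) (g ∘ suc) N))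
    (solve 4 (λ a b c d → a :+ b :+ (c :+ d) := a :+ c :+ (b :+ d)) ≡.refl _ _ _ _)

  ∑-zero : ∀ {f : ℕ → Carrier} → (∀ t → f t ≈ 0#) → ∀ N → ∑ (applyUpTo f N) ≈ 0#
  ∑-zero f≈0 zero    = refl
  ∑-zero f≈0 (suc N) = trans (+-cong (f≈0 0) (∑-zero (f≈0 ∘ suc) N)) (+-identityˡ 0#)

  ∑-nonneg : ∀ {f : ℕ → Carrier} → (∀ t → 0# ≤ f t) → ∀ N → 0# ≤ ∑ (applyUpTo f N)
  ∑-nonneg 0≤f zero    = ≤-refl
  ∑-nonneg 0≤f (suc N) = +-nonneg (0≤f 0) (∑-nonneg (0≤f ∘ suc) N)

  -- Hitting times: first-step analysis and comparison with potentials.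

  module Chain {S : Set} (step : S → Dist S) {Target : S → Set} (target? : Decidable Target) where

    open MarkovChain step target?

    private
      hits? : ∀ t → Decidable (λ ω → hittingTime ω ≡ just t)
      hits? t ω = Maybe.≡-dec ℕ._≟_ (hittingTime ω) (just t)

      at : ℕ → Maybe ℕ → Carrier
      at t h = indicator (does (Maybe.≡-dec ℕ._≟_ h (just t)))

      hits : ℕ → List S → Carrier
      hits t ω = at t (hittingTime ω)

      hittingTime-target : ∀ {s} ω → Target s → hittingTime (s ∷ ω) ≡ just 0
      hittingTime-target {s} ω s∈T with target? s
      ... | yes _   = ≡.refl
      ... | no  s∉T = contradiction s∈T s∉T

      hittingTime-∷ : ∀ {s} ω → ¬ Target s → hittingTime (s ∷ ω) ≡ Maybe.map suc (hittingTime ω)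
      hittingTime-∷ {s} ω s∉T with target? s
      ... | yes s∈T = contradiction s∈T s∉T
      ... | no  _ with List.findIndex target? ω
      ...   | just _  = ≡.refl
      ...   | nothing = ≡.refl

      hits-suc : ∀ t h → at (suc t) (Maybe.map suc h) ≡ at t h
      hits-suc t nothing  = ≡.refl
      hits-suc t (just k) = ≡.refl

    ℙ-suc : ∀ t s → ℙ[T≡ suc t ]from s ≈ expect (step s) (λ s′ → expect (trajectory t s′) (λ ω → hits (suc t) (s ∷ ω)))
    ℙ-suc t s = trans (prob-expect (trajectory (suc t) s) (hits? (suc t))) (trans
      (expect->>= (step s) (λ s′ → mapDist (s ∷_) (trajectory t s′)) (hits (suc t)))
      (expect-cong (step s) (λ s′ → expect-mapDist (s ∷_) (trajectory t s′) (hits (suc t)))))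

    ℙ-zero-target : ∀ {s} → Target s → ℙ[T≡ 0 ]from s ≈ 1#
    ℙ-zero-target {s} s∈T = trans (prob-expect (trajectory 0 s) (hits? 0)) (trans
      (+-congʳ (*-congˡ (reflexive (≡.cong (at 0) (hittingTime-target [] s∈T)))))
      (trans (+-identityʳ _) (*-identityˡ 1#)))

    ℙ-zero : ∀ {s} → ¬ Target s → ℙ[T≡ 0 ]from s ≈ 0#
    ℙ-zero {s} s∉T = trans (prob-expect (trajectory 0 s) (hits? 0)) (trans
      (+-congʳ (*-congˡ (reflexive (≡.cong (at 0) (hittingTime-∷ [] s∉T)))))
      (trans (+-identityʳ _) (*-identityˡ 0#)))

    ℙ-suc-target : ∀ t {s} → Target s → ℙ[T≡ suc t ]from s ≈ 0#
    ℙ-suc-target t {s} s∈T = trans (ℙ-suc t s) (trans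
      (expect-cong (step s) (λ s′ → trans
        (expect-cong (trajectory t s′) (λ ω → reflexive (≡.cong (at (suc t)) (hittingTime-target ω s∈T))))
        (expect-zero (trajectory t s′))))
      (expect-zero (step s)))

    -- The Markov property at time 1: off the target, prepending a state delays the hitting time by
    -- one.
    ℙ-suc-step : ∀ t {s} → ¬ Target s → ℙ[T≡ suc t ]from s ≈ expect (step s) (ℙ[T≡ t ]from_)
    ℙ-suc-step t {s} s∉T = trans (ℙ-suc t s) (expect-cong (step s) (λ s′ → trans
      (expect-cong (trajectory t s′) (λ ω → reflexive (≡.trans
        (≡.cong (at (suc t)) (hittingTime-∷ ω s∉T))
        (hits-suc t (hittingTime ω)))))
      (sym (prob-expect (trajectory t s′) (hits? t)))))

    -- The probability of `T < N`, and the expectation of `T` restricted to that event.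
    mass mean : ℕ → S → Carrier
    mass N s = ∑ (applyUpTo (λ t → ℙ[T≡ t ]from s) N)
    mean N s = ∑ (applyUpTo (λ t → fromℕ t * ℙ[T≡ t ]from s) N)

    mass-target : ∀ N {s} → Target s → mass (suc N) s ≈ 1#
    mass-target N s∈T = trans
      (+-cong (ℙ-zero-target s∈T) (∑-zero (λ t → ℙ-suc-target t s∈T) N)) (+-identityʳ 1#)

    mean-target : ∀ N {s} → Target s → mean N s ≈ 0#
    mean-target N s∈T = ∑-zero
      (λ { zero → zeroˡ _ ; (suc t) → trans (*-congˡ (ℙ-suc-target t s∈T)) (zeroʳ _) }) N

    mass-step : ∀ N {s} → ¬ Target s → mass (suc N) s ≈ expect (step s) (mass N)
    mass-step N {s} s∉T = trans
      (+-cong (ℙ-zero s∉T) (trans (∑-cong (λ t → ℙ-suc-step t s∉T) N) (expect-∑ (step s) ℙ[T≡_]from_ N)))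
      (+-identityˡ _)

    -- In `(1 + t) * P` the first summand collects the mass after one step and the second the mean.
    mean-step : ∀ N {s} → ¬ Target s →
      mean (suc N) s ≈ expect (step s) (mass N) + expect (step s) (mean N)
    mean-step N {s} s∉T = trans (+-congʳ (zeroˡ _)) (trans (+-identityˡ _) (trans
      (∑-cong (λ t → trans (*-congˡ (ℙ-suc-step t s∉T)) (trans
        (solve 2 (λ t e → (one :+ t) :* e := e :+ t :* e) ≡.refl (fromℕ t) _)
        (+-congˡ (sym (expect-* (step s) (fromℕ t) ℙ[T≡ t ]from_))))) N)
      (trans (∑-+ (λ t → expect (step s) ℙ[T≡ t ]from_) _ N)
        (+-cong (expect-∑ (step s) ℙ[T≡_]from_ N)
          (expect-∑ (step s) (λ t s′ → fromℕ t * ℙ[T≡ t ]from s′) N)))))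

    -- The expectation of min (T , N) + M · [ T ≥ N ].
    stopped : ℕ → Carrier → S → Carrier
    stopped N M s = mean N s + (fromℕ N + M) * (1# - mass N s)

    stopped-target : ∀ N M {s} → Target s → stopped (suc N) M s ≈ 0#
    stopped-target N M s∈T = trans
      (+-cong (mean-target (suc N) s∈T) (*-congˡ (+-congˡ (-‿cong (mass-target N s∈T)))))
      (solve 1 (λ c → con 0 :+ c :* (one :- one) := con 0) ≡.refl _)

    -- Hitting at time `t` contributes `1 + t`, not hitting contributes `1 + N + M`; in both cases
    -- one unit comes from the first step. Total weight `1#` turns these units into the summand
    -- `1#`.
    stopped-step : ∀ N M {s} → ¬ Target s → expect (step s) (λ _ → 1#) ≈ 1# →
      stopped (suc N) M s ≈ 1# + expect (step s) (stopped N M)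
    stopped-step N M {s} s∉T total = begin
      mean (suc N) s + (fromℕ (suc N) + M) * (1# - mass (suc N) s)
        ≈⟨ +-cong (mean-step N s∉T) (*-congˡ (+-congˡ (-‿cong (mass-step N s∉T)))) ⟩
      expect (step s) (mass N) + expect (step s) (mean N) + (1# + fromℕ N + M) * (1# - expect (step s) (mass N))
        ≈⟨ solve 4 (λ n M a b → a :+ b :+ (one :+ n :+ M) :* (one :- a) := one :+ (b :+ (n :+ M) :* (one :- a)))
             ≡.refl (fromℕ N) M _ _ ⟩
      1# + (expect (step s) (mean N) + (fromℕ N + M) * (1# - expect (step s) (mass N)))
        ≈⟨ +-congˡ (+-congˡ (*-congˡ (+-congʳ (sym total)))) ⟩
      1# + (expect (step s) (mean N) + (fromℕ N + M) * (expect (step s) (λ _ → 1#) - expect (step s) (mass N)))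
        ≈⟨ +-congˡ (trans (+-congˡ (trans (*-congˡ (sym (expect-- (step s) (mass N)))) (sym (expect-* (step s) _ _))))
             (sym (expect-+ (step s) (mean N) _))) ⟩
      1# + expect (step s) (stopped N M) ∎
      where open import Relation.Binary.Reasoning.Setoid setoid

    -- Before the target is hit, moves of nonzero weight do not leave `Good`. Thus inequalities for
    -- a potential are required on `Good` alone, and weights are controlled only there.
    module Closed {Good : S → Set}
      (closed : ∀ {s} → Good s → ¬ Target s → All (λ (p , s′) → 0# ≤ p × (p ≈ 0# ⊎ Good s′)) (step s))
      (total  : ∀ {s} → Good s → ¬ Target s → expect (step s) (λ _ → 1#) ≈ 1#) where

      private
        expect-mono-good : ∀ {s f g} → Good s → ¬ Target s → (∀ {s′} → Good s′ → f s′ ≤ g s′) →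
          expect (step s) f ≤ expect (step s) g
        expect-mono-good good s∉T f≤g = expect-mono
          (All.map (λ { (0≤p , inj₁ p≈0) → 0≤p , inj₁ p≈0 ; (0≤p , inj₂ good′) → 0≤p , inj₂ (f≤g good′) })
            (closed good s∉T))

      ℙ-nonneg : ∀ t {s} → Good s → 0# ≤ ℙ[T≡ t ]from s
      ℙ-nonneg zero {s} good with toSum (target? s)
      ... | inj₁ s∈T = ≤-trans 0≤1 (≤-reflexive (sym (ℙ-zero-target s∈T)))
      ... | inj₂ s∉T = ≤-reflexive (sym (ℙ-zero s∉T))
      ℙ-nonneg (suc t) {s} good with toSum (target? s)
      ... | inj₁ s∈T = ≤-reflexive (sym (ℙ-suc-target t s∈T))
      ... | inj₂ s∉T = ≤-resp (expect-zero (step s)) (sym (ℙ-suc-step t s∉T))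
        (expect-mono-good good s∉T (ℙ-nonneg t))

      mass≤1 : ∀ N {s} → Good s → mass N s ≤ 1#
      mass≤1 zero    good = 0≤1
      mass≤1 (suc N) {s} good with toSum (target? s)
      ... | inj₁ s∈T = ≤-reflexive (mass-target N s∈T)
      ... | inj₂ s∉T = ≤-resp (sym (mass-step N s∉T)) (total good s∉T) (expect-mono-good good s∉T (mass≤1 N))

      -- The inequality `V ≤ 1 + P V` is iterated `N` times: trajectories at the target end with the
      -- value 0, and on the others `V` is replaced by its bound `M`.
      ≤-stopped : ∀ {V M} → 0# ≤ M → (∀ {s} → Good s → V s ≤ M) → (∀ {s} → Good s → Target s → V s ≤ 0#) →
        (∀ {s} → Good s → ¬ Target s → V s ≤ 1# + expect (step s) V) →
        ∀ N {s} → Good s → V s ≤ stopped N M s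
      ≤-stopped {V} {M} 0≤M V≤M V≤0 sub zero good = ≤-trans (V≤M good)
        (≤-reflexive (solve 1 (λ M → M := con 0 :+ (con 0 :+ M) :* (one :- con 0)) ≡.refl M))
      ≤-stopped {V} {M} 0≤M V≤M V≤0 sub (suc N) {s} good with toSum (target? s)
      ... | inj₁ s∈T = ≤-trans (V≤0 good s∈T) (≤-reflexive (sym (stopped-target N M s∈T)))
      ... | inj₂ s∉T = ≤-trans (sub good s∉T) (≤-resp refl (sym (stopped-step N M s∉T (total good s∉T)))
        (+-monoʳ-≤ 1# (expect-mono-good good s∉T (≤-stopped 0≤M V≤M V≤0 sub N))))

      -- The opposite iteration: trajectories that have not ended after `N` steps contribute a
      -- nonnegative value of `V`, which is dropped.
      stopped-≤ : ∀ {V} → (∀ {s} → Good s → 0# ≤ V s) →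
        (∀ {s} → Good s → ¬ Target s → 1# + expect (step s) V ≤ V s) →
        ∀ N {s} → Good s → stopped N 0# s ≤ V s
      stopped-≤ {V} 0≤V sup zero good = ≤-trans
        (≤-reflexive (solve 0 (con 0 :+ (con 0 :+ con 0) :* (one :- con 0) := con 0) ≡.refl)) (0≤V good)
      stopped-≤ {V} 0≤V sup (suc N) {s} good with toSum (target? s)
      ... | inj₁ s∈T = ≤-trans (≤-reflexive (stopped-target N 0# s∈T)) (0≤V good)
      ... | inj₂ s∉T = ≤-trans (≤-resp (sym (stopped-step N 0# s∉T (total good s∉T))) refl
        (+-monoʳ-≤ 1# (expect-mono-good good s∉T (stopped-≤ 0≤V sup N)))) (sup good s∉T)

      private
        -- The sum of (N - t) P t over t < K is largest for K = N.
        partialMean-bound : ∀ (P : ℕ → Carrier) → (∀ t → 0# ≤ P t) → ∀ N K →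
          fromℕ N * ∑ (applyUpTo P K) - ∑ (applyUpTo (λ t → fromℕ t * P t) K)
            ≤ fromℕ N * ∑ (applyUpTo P N) - ∑ (applyUpTo (λ t → fromℕ t * P t) N)
        partialMean-bound P 0≤P zero K = ≤-resp (+-congʳ (sym (zeroˡ _))) (+-congʳ (sym (zeroˡ _)))
          (+-monoʳ-≤ 0# (-‿anti-≤ (∑-nonneg (λ t → *-nonneg (fromℕ-nonneg t) (0≤P t)) K)))
        partialMean-bound P 0≤P (suc N) K = ≤-trans (below K)
          (≤-reflexive (sym (shift N)))
          where
          D : ℕ → Carrier
          D K = fromℕ N * ∑ (applyUpTo (P ∘ suc) K) - ∑ (applyUpTo (λ t → fromℕ t * P (suc t)) K)
          shift : ∀ K → fromℕ (suc N) * ∑ (applyUpTo P (suc K)) - ∑ (applyUpTo (λ t → fromℕ t * P t) (suc K))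
            ≈ fromℕ (suc N) * P 0 + D K
          shift K = trans
            (+-congˡ (-‿cong (+-congˡ (trans
              (∑-cong (λ t → solve 2 (λ t e → (one :+ t) :* e := e :+ t :* e) ≡.refl (fromℕ t) (P (suc t))) K)
              (∑-+ (P ∘ suc) _ K)))))
            (solve 4 (λ n p m e → (one :+ n) :* (p :+ m) :- (con 0 :* p :+ (m :+ e)) := (one :+ n) :* p :+ (n :* m :- e))
              ≡.refl (fromℕ N) (P 0) _ _)
          0≤P₀ : 0# ≤ fromℕ (suc N) * P 0
          0≤P₀ = *-nonneg (fromℕ-nonneg (suc N)) (0≤P 0)
          IH : ∀ K → D K ≤ D N
          IH = partialMean-bound (P ∘ suc) (0≤P ∘ suc) N
          below : ∀ K → fromℕ (suc N) * ∑ (applyUpTo P K) - ∑ (applyUpTo (λ t → fromℕ t * P t) K)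
            ≤ fromℕ (suc N) * P 0 + D N
          below zero    = ≤-trans (≤-reflexive (solve 2 (λ c n → c :* con 0 :- con 0 := n :* con 0 :- con 0) ≡.refl (fromℕ (suc N)) (fromℕ N)))
            (≤-trans (IH 0) (≤-resp (+-identityˡ _) refl (+-monoˡ-≤ (D N) 0≤P₀)))
          below (suc K) = ≤-trans (≤-reflexive (shift K)) (+-monoʳ-≤ _ (IH K))

        -- Passage to the limit: the supremum of `mass N s` is `1#`, so that of `c * mass N s` is
        -- `c`. For positive `c` the bound is divided by `c`; otherwise `N = 0` gives `0# ≤ b`.
        scale-mass : ∀ {s c b} → (∀ v → 0# ≤ v → (∀ N → mass N s ≤ v) → 1# ≤ v) → 0# ≤ c →
          (∀ N → c * mass N s ≤ b) → c ≤ b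
        scale-mass {s} {c} {b} least 0≤c cm≤b with em {c ≤ 0#}
        ... | yes c≤0 = ≤-trans c≤0 0≤b
          where
          0≤b : 0# ≤ b
          0≤b = ≤-resp (zeroʳ c) refl (cm≤b 0)
        ... | no c≰0 = ≤-resp (*-identityʳ c) (cancel b) (*-monoˡ-≤ 0≤c
            (least (c ⁻¹ * b) (*-nonneg (⁻¹-pos 0<c) (≤-resp (zeroʳ c) refl (cm≤b 0)))
              (λ N → *-cancelˡ-≤ 0<c (≤-resp refl (sym (cancel b)) (cm≤b N)))))
          where
          0<c : 0# < c
          0<c = ≰⇒> c≰0
          cancel : ∀ x → c * (c ⁻¹ * x) ≈ x
          cancel x = trans (sym (*-assoc c (c ⁻¹) x)) (trans (*-congʳ (*-inverse-pos 0<c)) (*-identityˡ x))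

        Total : S → Set
        Total s = ∑∞ (λ t → ℙ[T≡ t ]from s) ≈∞ fin 1#

        mass-least : ∀ {s} → Total s → ∀ v → 0# ≤ v → (∀ N → mass N s ≤ v) → 1# ≤ v
        mass-least {s} tot v 0≤v m≤v with sup∞-cases (λ x → ∃ λ N → x ≈ mass N s)
        ... | inj₂ (_ , unbounded) = contradiction (λ { x (N , x≈m) → ≤-trans (≤-reflexive x≈m) (m≤v N) }) (unbounded v 0≤v)
        ... | inj₁ (σ , eq , _ , _ , least) with ≡.subst (_≈∞ fin 1#) eq tot
        ...   | σ≈1 = ≤-trans (≤-reflexive (sym σ≈1))
          (least v 0≤v λ { x (N , x≈m) → ≤-trans (≤-reflexive x≈m) (m≤v N) })

      -- Suppose that the mean is a finite `E`. Then `N (1 - mass N) ≤ E - mean N`, whence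
      -- `stopped N M s ≤ E + M (1 - mass N)`, and the last term vanishes in the limit.
      ≤-expectedHittingTime : ∀ {s V M} → Good s → 0# ≤ M → (∀ N → V ≤ stopped N M s) →
        fin V ≤∞ expectedHittingTime s
      ≤-expectedHittingTime {s} {V} {M} good 0≤M V≤ with em {Total s}
      ... | no  _   = tt
      ... | yes tot with sup∞-cases (λ x → ∃ λ N → x ≈ mean N s)
      ...   | inj₂ (eq , _) rewrite eq = tt
      ...   | inj₁ (E , eq , _ , ub , _) rewrite eq = 0≤y-x⇒x≤y (≤-resp refl
          (solve 3 (λ E M V → E :+ M :- V :- M := E :- V) ≡.refl E M V)
          (x≤y⇒0≤y-x (scale-mass least 0≤M (λ N → 0≤y-x⇒x≤y (≤-resp refl
            (solve 6 (λ E M V n e m → (E :+ (n :* m :- e) :- n) :+ (e :+ (n :+ M) :* (one :- m) :- V)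
                := E :+ M :- V :- M :* m) ≡.refl E M V (fromℕ N) (mean N s) (mass N s))
            (+-nonneg (x≤y⇒0≤y-x (tail N)) (x≤y⇒0≤y-x (V≤ N))))))))
          where
          least : ∀ v → 0# ≤ v → (∀ N → mass N s ≤ v) → 1# ≤ v
          least = mass-least tot
          -- For every `K`, `partialMean-bound` and `mean K s ≤ E` bound `N * mass K s` by the
          -- right-hand side; then `K` grows.
          tail : ∀ N → fromℕ N ≤ E + (fromℕ N * mass N s - mean N s)
          tail N = scale-mass least (fromℕ-nonneg N) (λ K → ≤-resp
            (solve 2 (λ a e → e :+ (a :- e) := a) ≡.refl (fromℕ N * mass K s) (mean K s)) refl
            (+-mono-≤ (ub _ (K , refl)) (partialMean-bound (λ t → ℙ[T≡ t ]from s) (λ t → ℙ-nonneg t good) N K)))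

      private
        0≤-stopped : ∀ {s V} → (∀ N → stopped N 0# s ≤ V) → 0# ≤ V
        0≤-stopped ≤V = ≤-trans
          (≤-reflexive (solve 0 (con 0 := con 0 :+ (con 0 :+ con 0) :* (one :- con 0)) ≡.refl)) (≤V 0)

        mean-≤ : ∀ {s V} → Good s → (∀ N → stopped N 0# s ≤ V) → UpperBound (λ x → ∃ λ N → x ≈ mean N s) V
        mean-≤ {s} good ≤V x (N , x≈e) = ≤-trans (≤-reflexive x≈e) (≤-trans
          (≤-resp (+-identityʳ _) refl (+-monoʳ-≤ (mean N s)
            (*-nonneg (+-nonneg (fromℕ-nonneg N) ≤-refl) (x≤y⇒0≤y-x (mass≤1 N good)))))
          (≤V N))

      -- From `N (1 - mass N) ≤ V` for all `N`, the Archimedean property forces the supremum of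
      -- `mass N` to be 1, so `T` is finite almost surely. After that, `mean N ≤ V` bounds the
      -- series.
      expectedHittingTime-≤ : ∀ {s V} → Good s → (∀ N → stopped N 0# s ≤ V) →
        ∃ λ E → expectedHittingTime s ≡ fin E × E ≤ V
      expectedHittingTime-≤ {s} {V} good ≤V with em {Total s}
      ... | no ¬total = contradiction total′ ¬total
        where
        0≤mean : ∀ N → 0# ≤ mean N s
        0≤mean = ∑-nonneg (λ t → *-nonneg (fromℕ-nonneg t) (ℙ-nonneg t good))
        missing : ∀ N → fromℕ N * (1# - mass N s) ≤ V
        missing N = ≤-trans (≤-resp
          (+-identityˡ _) (+-congˡ (*-congʳ (sym (+-identityʳ _)))) (+-monoˡ-≤ _ (0≤mean N))) (≤V N)
        mass≤1′ : UpperBound (λ x → ∃ λ N → x ≈ mass N s) 1#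
        mass≤1′ x (N , x≈m) = ≤-trans (≤-reflexive x≈m) (mass≤1 N good)
        total′ : Total s
        total′ with sup∞-bounded (λ x → ∃ λ N → x ≈ mass N s) 0≤1 mass≤1′
        ... | σ , eq , _ , ub , least = ≡.subst (_≈∞ fin 1#) (≡.sym eq) (≤-antisym
          (least 1# 0≤1 mass≤1′)
          (0≤y-x⇒x≤y (≤-resp refl (solve 1 (λ σ → :- (one :- σ) := σ :- one) ≡.refl σ)
            (x≤0⇒0≤-x (archimedean-nonpos (λ N → ≤-trans
              (*-monoˡ-≤ (fromℕ-nonneg N) (+-monoʳ-≤ 1# (-‿anti-≤ (ub _ (N , refl))))) (missing N)))))))
      ... | yes _ with sup∞-bounded (λ x → ∃ λ N → x ≈ mean N s) (0≤-stopped ≤V) (mean-≤ good ≤V)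
      ...   | E , eq , _ , _ , least = E , eq , least V (0≤-stopped ≤V) (mean-≤ good ≤V)

      -- The step equation is used in both directions: nonnegativity of `V` serves the upper
      -- estimate, boundedness the lower one.
      expectedHittingTime-≈ : ∀ {V M} → 0# ≤ M → (∀ s → 0# ≤ V s) → (∀ s → V s ≤ M) →
        (∀ {s} → Target s → V s ≈ 0#) →
        (∀ {s} → Good s → ¬ Target s → V s ≈ 1# + expect (step s) V) →
        ∀ {s} → Good s → expectedHittingTime s ≈∞ fin (V s)
      expectedHittingTime-≈ {V} {M} 0≤M 0≤V V≤M V≈0 V-step {s} good
        with expectedHittingTime s
           | expectedHittingTime-≤ {V = V s} good
               (λ N → stopped-≤ {V} (λ {s} _ → 0≤V s) (λ good s∉T → ≤-reflexive (sym (V-step good s∉T))) N good)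
           | ≤-expectedHittingTime {V = V s} good 0≤M
               (λ N → ≤-stopped {V} 0≤M (λ {s} _ → V≤M s) (λ _ s∈T → ≤-reflexive (V≈0 s∈T))
                 (λ good s∉T → ≤-reflexive (V-step good s∉T)) N good)
      ... | _ | E , ≡.refl , E≤V | V≤E = ≤-antisym E≤V V≤E

-- Polynomial expressions of the certificate.

quarticᴱ : ∀ {n} → Expr n → Expr n
quarticᴱ x = :- con 12 :+ con 52 :* x :+ con 39 :* x :^ 2 :+ con 12 :* x :^ 3 :- con 3 :* x :^ 4

-- The moves are: both up, x up and y down, x down and y up, both down.
branchᴱ : ∀ {n} (P Q a b c d : Expr n) → Expr n
branchᴱ P Q a b c d = P :* Q :* a :+ (P :* (one :- Q) :* b :+ ((one :- P) :* Q :* c :+ ((one :- P) :* (one :- Q) :* d :+ con 0)))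

-- L = 2992 clears the denominators of α, of the intercept and slope of u, and of c₁ and c₂ as
-- elements of ℚ(t); e₁ and e₂ are the cofactors of the quartic at (1 , 1) and (-1 , 1).
module Certificate {n : ℕ} (t p : Expr n) where

  private
    cubic : (c₀ c₁ c₂ c₃ : ℕ) → Expr n
    cubic c₀ c₁ c₂ c₃ = con c₀ :+ con c₁ :* t :+ con c₂ :* (t :* t) :- con c₃ :* (t :* t :* t)

    k = cubic 2596 2160 372 120

  -- Everything is multiplied by `L`, and `- k` is the slope of `½u` in `p`; working with half of
  -- `u` keeps the coefficients of `m` and `g` integral. The step equation at (0 , 2) has the value
  -- `m` for `r = 0`, and `g` is the coefficient of `r` in it.
  L q α ½u u v m g h₁₃ h₋₁₃ A B c₁ c₂ : Expr n
  L    = con 2992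
  q    = one :- p
  α    = cubic 17380 9240 3399 825
  ½u   = cubic 9232 7320 3006 690 :- k :* p
  u    = con 2 :* ½u
  v    = con 4 :* α :- con 4 :* L :- con 2 :* u
  m    = con 2 :* α :- L :- ½u
  g    = con 2 :* L :+ con 2 :* L :* p :- p :* ½u
  h₁₃  = L :+ con 5 :* L :* p :+ q :* m
  h₋₁₃ = L :+ p :* (L :+ v) :+ q :* m
  B    = q :* g :- p :* (con 2 :* u :- h₁₃)
  A    = u :- h₁₃ :+ con 5 :* L
  c₁   = cubic 16016 11784 2391 717 :- con 3 :* k :* p
  c₂   = cubic 3036 984 531 117 :+ con 2 :* k :* p

  e₁ e₂ : Expr n
  e₁ = con 120 :* t :* p :- con 239 :* t :- con 240 :* (p :* p) :+ con 586 :* p :- con 159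
  e₂ = con 160 :* (p :* p) :- con 80 :* t :* p :- con 39 :* t :+ con 6 :* p :+ con 21

-- The root lies between `rootNumerator / rootScale` and `(rootNumerator + 1) / rootScale`.
rootNumerator rootScale : ℕ
rootNumerator = 19925700419229
rootScale     = 10 ℕ.^ 14

-- Inequalities and step equations for the values of the potential.

module Potential (em : ExcludedMiddle 0ℓ) (ℝ : CompleteOrderedField) where

  open CompleteOrderedField ℝ
  open OrderedField ℝ
  open Polynomial ℝ
  open Rendezvous em ℝ

  branch : (P Q a b c d : Carrier) → Carrier
  branch P Q a b c d = P * Q * a + (P * (1# - Q) * b + ((1# - P) * Q * c + ((1# - P) * (1# - Q) * d + 0#)))

  2½≈1 : fromℕ 2 * ½ ≈ 1#
  2½≈1 = trans (*-congˡ (*-identityˡ _)) (*-inverse-pos (fromℕ-pos 2))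

  IsRoot : Carrier → Set
  IsRoot t = fromℕ rootNumerator ≤ fromℕ rootScale * t × fromℕ rootScale * t ≤ fromℕ (suc rootNumerator) × quartic t ≈ 0#

  module Bounds {t : Carrier} (isRoot : IsRoot t) {p : Carrier} (0≤p≤1 : Unit p) where

    module C = Certificate {2} (var 0F) (var 1F)

    ρ : Vec Carrier 2
    ρ = t ∷ p ∷ []

    L α u v m g h₁₃ h₋₁₃ A B : Carrier
    L    = ⟦ C.L ⟧ ρ
    α    = ⟦ C.α ⟧ ρ
    u    = ⟦ C.u ⟧ ρ
    v    = ⟦ C.v ⟧ ρ
    m    = ⟦ C.m ⟧ ρ
    g    = ⟦ C.g ⟧ ρ
    h₁₃  = ⟦ C.h₁₃ ⟧ ρ
    h₋₁₃ = ⟦ C.h₋₁₃ ⟧ ρ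
    A    = ⟦ C.A ⟧ ρ
    B    = ⟦ C.B ⟧ ρ

    certify : ∀ d (l r : Expr 2) →
      nonneg? 1 d (swap 0 (zoom 1 rootScale rootNumerator (normalise (r :- l)))) ≡ true →
      ⟦ l ⟧ ρ ≤ ⟦ r ⟧ ρ
    certify d l r eq = 0≤y-x⇒x≤y (prove-nonneg rootScale rootNumerator d (r :- l) eq (proj₁ isRoot) (proj₁ (proj₂ isRoot)) 0≤p≤1)

    private
      _∙L : ℕ → Expr 2
      k ∙L = con k :* C.L

    5L≤α : ⟦ 5 ∙L ⟧ ρ ≤ α
    5L≤α = certify 6 (5 ∙L) C.α ≡.refl

    5L≤u : ⟦ 5 ∙L ⟧ ρ ≤ u
    5L≤u = certify 6 (5 ∙L) C.u ≡.refl

    5L≤v : ⟦ 5 ∙L ⟧ ρ ≤ v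
    5L≤v = certify 6 (5 ∙L) C.v ≡.refl

    6L≤m : ⟦ 6 ∙L ⟧ ρ ≤ m
    6L≤m = certify 6 (6 ∙L) C.m ≡.refl

    -- The difference of the two sides vanishes at `p = 1`; the factor `1 - p` is split off, and the
    -- inequality `5 L ≤ m` is certified for the other factor.
    6L≤h₁₃ : ⟦ 6 ∙L ⟧ ρ ≤ h₁₃
    6L≤h₁₃ = 0≤y-x⇒x≤y (≤-resp refl
      (prove {2} (C.q :* (C.m :- con 5 :* C.L)) (C.h₁₃ :- 6 ∙L) ≡.refl ρ)
      (*-nonneg (x≤y⇒0≤y-x (proj₂ 0≤p≤1)) (x≤y⇒0≤y-x (certify 6 (5 ∙L) C.m ≡.refl))))

    v≤h₋₁₃ : v ≤ h₋₁₃
    v≤h₋₁₃ = certify 6 C.v C.h₋₁₃ ≡.refl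

    0≤g : 0# ≤ g
    0≤g = certify 6 (con 0) C.g ≡.refl

    0≤L : 0# ≤ L
    0≤L = certify 6 (con 0) C.L ≡.refl

    α≤15L : α ≤ ⟦ 15 ∙L ⟧ ρ
    α≤15L = certify 6 C.α (15 ∙L) ≡.refl

    u≤15L : u ≤ ⟦ 15 ∙L ⟧ ρ
    u≤15L = certify 6 C.u (15 ∙L) ≡.refl

    v≤15L : v ≤ ⟦ 15 ∙L ⟧ ρ
    v≤15L = certify 6 C.v (15 ∙L) ≡.refl

    m+g≤15L : m + g ≤ ⟦ 15 ∙L ⟧ ρ
    m+g≤15L = certify 6 (C.m :+ C.g) (15 ∙L) ≡.refl

    h₁₃≤15L : h₁₃ ≤ ⟦ 15 ∙L ⟧ ρ
    h₁₃≤15L = certify 6 C.h₁₃ (15 ∙L) ≡.refl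

    h₋₁₃≤15L : h₋₁₃ ≤ ⟦ 15 ∙L ⟧ ρ
    h₋₁₃≤15L = certify 6 C.h₋₁₃ (15 ∙L) ≡.refl

    private
      -- Completing the square: `4 a` times the quadratic is `(2 a y + b)²` plus `4 c a - b²`.
      quadratic-nonneg : ∀ {a b c} y → 0# < a → b * b ≤ fromℕ 4 * c * a → 0# ≤ c + y * b + y * y * a
      quadratic-nonneg {a} {b} {c} y 0<a disc = *-cancelˡ-≤ {z = fromℕ 4 * a} (*-pos (fromℕ-pos 4) 0<a) (≤-resp
        (sym (zeroʳ _))
        (solve 4 (λ a b c y → (con 2 :* a :* y :+ b) :* (con 2 :* a :* y :+ b) :+ (con 4 :* c :* a :- b :* b)
          := con 4 :* a :* (c :+ y :* b :+ y :* y :* a)) ≡.refl a b c y)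
        (+-nonneg (sq-nonneg _) (x≤y⇒0≤y-x disc)))
        where
        *-pos : ∀ {x y} → 0# < x → 0# < y → 0# < x * y
        *-pos {x} {y} 0<x 0<y = *-nonneg (proj₁ 0<x) (proj₁ 0<y) , λ 0≈xy → <⇒≱ 0<y
          (*-cancelˡ-≤ 0<x (≤-reflexive (trans (sym 0≈xy) (sym (zeroʳ x)))))

    -- G₀ is the surplus of the inequality at (1 , 1) when r = 0; in general (p r) B + (p r)² A is added.
    G₀ : Carrier
    G₀ = (p - t) * (p - t) * ⟦ C.c₁ ⟧ ρ

    0≤c₁ : 0# ≤ ⟦ C.c₁ ⟧ ρ
    0≤c₁ = certify 6 (con 0) C.c₁ ≡.refl

    0≤c₂ : 0# ≤ ⟦ C.c₂ ⟧ ρ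
    0≤c₂ = certify 6 (con 0) C.c₂ ≡.refl

    0<A : 0# < A
    0<A = <-≤-trans (fromℕ-pos 2992) (certify 6 C.L C.A ≡.refl)

    -- It holds on the whole unit interval, so it can be certified there; for `4 p ≤ 1` its
    -- left-hand side is nonnegative and yields `0 ≤ B`.
    B-bound : fromℕ 7 * L * (1# - fromℕ 4 * p) ≤ fromℕ 4 * B
    B-bound = certify 6 (con 7 :* C.L :* (one :- con 4 :* var 1F)) (con 4 :* C.B) ≡.refl

    -- For `4 p ≥ 1` the first summand is nonnegative and `B * B ≤ 4 G₀ A` remains. At `p = t`,
    -- where `G₀` vanishes but `B` does not, the negative first summand makes the inequality
    -- possible.
    discriminant-bound : fromℕ 6 * L * L * (fromℕ 4 * p - 1#) + fromℕ 4 * (B * B) ≤ fromℕ 4 * (fromℕ 4 * G₀ * A)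
    discriminant-bound = certify 8 (con 6 :* C.L :* C.L :* (con 4 :* var 1F :- one) :+ con 4 :* (C.B :* C.B))
      (con 4 :* (con 4 :* ((var 1F :- var 0F) :* (var 1F :- var 0F) :* C.c₁) :* C.A)) ≡.refl

    0≤7L : 0# ≤ fromℕ 7 * L
    0≤7L = *-nonneg (fromℕ-nonneg 7) 0≤L

    0≤6LL : 0# ≤ fromℕ 6 * L * L
    0≤6LL = *-nonneg (*-nonneg (fromℕ-nonneg 6) 0≤L) 0≤L

    -- For p ≤ 1/4 the linear coefficient B is nonnegative; for p ≥ 1/4 the discriminant is nonpositive.
    quadratic-part : ∀ y → 0# ≤ y → 0# ≤ G₀ + y * B + y * y * A
    quadratic-part y 0≤y = [ small , large ]′ (≤-total (fromℕ 4 * p) 1#)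
      where
      small : fromℕ 4 * p ≤ 1# → 0# ≤ G₀ + y * B + y * y * A
      small 4p≤1 = +-nonneg (+-nonneg (*-nonneg (sq-nonneg (p - t)) 0≤c₁) (*-nonneg 0≤y 0≤B))
                     (*-nonneg (sq-nonneg y) (proj₁ 0<A))
        where
        0≤B : 0# ≤ B
        0≤B = *-cancelˡ-≤ (fromℕ-pos 4) (≤-trans (≤-reflexive (zeroʳ (fromℕ 4)))
          (≤-trans (*-nonneg 0≤7L (x≤y⇒0≤y-x 4p≤1)) B-bound))
      large : 1# ≤ fromℕ 4 * p → 0# ≤ G₀ + y * B + y * y * A
      large 1≤4p = quadratic-nonneg y 0<A (*-cancelˡ-≤ (fromℕ-pos 4) (≤-trans
        (≤-trans (≤-reflexive (sym (+-identityˡ _)))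
          (+-monoˡ-≤ (fromℕ 4 * (B * B)) (*-nonneg 0≤6LL (x≤y⇒0≤y-x 1≤4p))))
        discriminant-bound))

    root : quartic t ≈ 0#
    root = proj₂ (proj₂ isRoot)

    -- Reduces an identity modulo a relation `z ≈ 0#` to a polynomial identity with explicit
    -- cofactor `c`. The relations are the quartic and `2 ½ - 1`.
    modulo : ∀ {x y z c} → z ≈ 0# → x ≈ y + z * c → x ≈ y
    modulo z≈0 x≈ = trans x≈ (trans (+-congˡ (trans (*-congʳ z≈0) (zeroˡ _))) (+-identityʳ _))

    2½-1≈0 : fromℕ 2 * ½ - 1# ≈ 0#
    2½-1≈0 = trans (+-congʳ 2½≈1) (-‿inverseʳ 1#)

    module Steps (r : Carrier) where

      module C′ = Certificate {4} (var 0F) (var 1F)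

      -- Coefficients are integers, so `½` enters as a variable of its own, subject to `2½-1≈0`.
      ρ′ : Vec Carrier 4
      ρ′ = t ∷ p ∷ r ∷ ½ ∷ []

      tᴱ pᴱ rᴱ ½ᴱ 2½-1ᴱ wᴱ h₂₂ᴱ yᴱ G₀ᴱ : Expr 4
      tᴱ    = var 0F
      pᴱ    = var 1F
      rᴱ    = var 2F
      ½ᴱ    = var 3F
      2½-1ᴱ = con 2 :* ½ᴱ :- one
      wᴱ    = C′.m :+ rᴱ :* C′.g
      h₂₂ᴱ  = C′.L :+ branchᴱ rᴱ rᴱ (con 5 :* C′.L) (con 0) C′.h₁₃ C′.u
      yᴱ    = pᴱ :* rᴱ
      G₀ᴱ   = (pᴱ :- tᴱ) :* (pᴱ :- tᴱ) :* C′.c₁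

      w h₂₂ : Carrier
      w   = ⟦ wᴱ ⟧ ρ′
      h₂₂ = ⟦ h₂₂ᴱ ⟧ ρ′

      α-step : L + branch ½ ½ u 0# v u ≈ α
      α-step = modulo 2½-1≈0 (prove {4}
        (C′.L :+ branchᴱ ½ᴱ ½ᴱ C′.u (con 0) C′.v C′.u)
        (C′.α :+ 2½-1ᴱ :* (2½-1ᴱ :* (C′.u :- C′.α :+ C′.L))) ≡.refl ρ′)

      w-step : L + branch ½ r h₁₃ u h₋₁₃ v ≈ w
      w-step = modulo 2½-1≈0 (prove {4}
        (C′.L :+ branchᴱ ½ᴱ rᴱ C′.h₁₃ C′.u C′.h₋₁₃ C′.v)
        (wᴱ :+ 2½-1ᴱ :* (wᴱ :- C′.L :- (rᴱ :* C′.h₋₁₃ :+ (one :- rᴱ) :* C′.v))) ≡.refl ρ′)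

      -- The right-hand side is `m + r g` at `r = 1`: this is the step equation at (0 , 2) with the
      -- second agent certain to move up.
      m-step : L + (½ * h₁₃ + (1# - ½) * h₋₁₃) ≈ m + g
      m-step = modulo 2½-1≈0 (prove {4}
        (C′.L :+ (½ᴱ :* C′.h₁₃ :+ (one :- ½ᴱ) :* C′.h₋₁₃))
        (C′.m :+ C′.g :+ 2½-1ᴱ :* (C′.m :- C′.L :+ C′.g :- C′.h₋₁₃)) ≡.refl ρ′)

      h₁₃-step : L + (p * (fromℕ 5 * L) + (1# - p) * m) ≈ h₁₃
      h₁₃-step = prove {4} (C′.L :+ (pᴱ :* (con 5 :* C′.L) :+ (one :- pᴱ) :* C′.m)) C′.h₁₃ ≡.refl ρ′

      h₋₁₃-step : L + ((1# - p) * m + (1# - (1# - p)) * (L + v)) ≈ h₋₁₃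
      h₋₁₃-step = prove {4}
        (C′.L :+ ((one :- pᴱ) :* C′.m :+ (one :- (one :- pᴱ)) :* (C′.L :+ C′.v))) C′.h₋₁₃ ≡.refl ρ′

      u-step : L + branch p p h₂₂ 0# w α ≈ u + (G₀ + p * r * B + p * r * (p * r) * A)
      u-step = modulo root (prove {4}
        (C′.L :+ branchᴱ pᴱ pᴱ h₂₂ᴱ (con 0) wᴱ C′.α)
        (C′.u :+ (G₀ᴱ :+ yᴱ :* C′.B :+ yᴱ :* yᴱ :* C′.A) :+ quarticᴱ tᴱ :* C′.e₁) ≡.refl ρ′)

      -- Two moves of total weight `2 p (1 - p)` lead to states of value `w = m + r g`, which
      -- accounts for the last summand. The part without `r` is a square multiple of `c₂` modulo the
      -- quartic.
      v-step : L + branch (1# - p) p w α (L + v) w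
        ≈ v + ((p - t) * (p - t) * ⟦ C.c₂ ⟧ ρ + fromℕ 2 * (p * (1# - p)) * (r * g))
      v-step = modulo root (prove {4}
        (C′.L :+ branchᴱ (one :- pᴱ) pᴱ wᴱ C′.α (C′.L :+ C′.v) wᴱ)
        (C′.v :+ ((pᴱ :- tᴱ) :* (pᴱ :- tᴱ) :* C′.c₂ :+ con 2 :* (pᴱ :* (one :- pᴱ)) :* (rᴱ :* C′.g))
          :+ quarticᴱ tᴱ :* C′.e₂) ≡.refl ρ′)

-- The potential on the lattice of positions and its step inequality.

module Lattice (em : ExcludedMiddle 0ℓ) (ℝ : CompleteOrderedField) where

  open CompleteOrderedField ℝ
  open OrderedField ℝ
  open Polynomial ℝ
  open Rendezvous em ℝ
  open Potential em ℝ

  -- All values are scaled by L.  The states of α, u, v, w, h₂₂, h₁₃, h₋₁₃ are (0 , 0), (1 , 1),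
  -- (-1 , 1), (0 , 2), (2 , 2), (1 , 3), (-1 , 3); M bounds all values.
  record Constants (p r : Carrier) : Set where
    field
      L M α u v m w h₂₂ h₁₃ h₋₁₃ : Carrier
      0<L       : 0# < L
      5L≤α      : fromℕ 5 * L ≤ α
      5L≤u      : fromℕ 5 * L ≤ u
      5L≤v      : fromℕ 5 * L ≤ v
      5L≤m      : fromℕ 5 * L ≤ m
      5L≤h₂₂    : fromℕ 5 * L ≤ h₂₂
      5L≤h₁₃    : fromℕ 5 * L ≤ h₁₃
      v≤h₋₁₃    : v ≤ h₋₁₃
      m≤w       : m ≤ w
      6L≤M      : fromℕ 6 * L ≤ M
      α≤M       : α ≤ M
      u≤M       : u ≤ M
      h₂₂≤M     : h₂₂ ≤ M
      w≤M       : w ≤ M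
      h₁₃≤M     : h₁₃ ≤ M
      h₋₁₃≤M    : h₋₁₃ ≤ M
      L+v≤M     : L + v ≤ M
      α-step    : α ≤ L + branch ½ ½ u 0# v u
      u-step    : u ≤ L + branch p p h₂₂ 0# w α
      v-step    : v ≤ L + branch (1# - p) p w α (L + v) w
      w-step    : w ≤ L + branch ½ r h₁₃ u h₋₁₃ v
      m-step    : m ≤ L + (½ * h₁₃ + (1# - ½) * h₋₁₃)
      h₂₂-step  : h₂₂ ≤ L + branch r r (fromℕ 5 * L) 0# h₁₃ u
      h₁₃-step  : h₁₃ ≤ L + (p * (fromℕ 5 * L) + (1# - p) * m)
      h₋₁₃-step : h₋₁₃ ≤ L + ((1# - p) * m + (1# - (1# - p)) * (L + v))

  unit-½ : Unit ½
  unit-½ = 0≤½ , 0≤y-x⇒x≤y (≤-resp refl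
    (trans (solve 1 (λ h → h := con 2 :* h :- h) ≡.refl ½) (+-congʳ 2½≈1)) 0≤½)
    where
    0≤½ : 0# ≤ ½
    0≤½ = *-nonneg 0≤1 (⁻¹-pos (fromℕ-pos 2))

  unit-complement : ∀ {x} → Unit x → Unit (1# - x)
  unit-complement {x} (0≤x , x≤1) = x≤y⇒0≤y-x x≤1 ,
    0≤y-x⇒x≤y (≤-resp refl (solve 1 (λ x → x := one :- (one :- x)) ≡.refl x) 0≤x)

  branch-mono : ∀ {P Q a b c d a′ b′ c′ d′} → Unit P → Unit Q → a ≤ a′ → b ≤ b′ → c ≤ c′ → d ≤ d′ →
    branch P Q a b c d ≤ branch P Q a′ b′ c′ d′
  branch-mono {P} {Q} uP uQ a≤ b≤ c≤ d≤ =
    +-mono-≤ (*-monoˡ-≤ (*-nonneg (proj₁ uP) (proj₁ uQ)) a≤)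
      (+-mono-≤ (*-monoˡ-≤ (*-nonneg (proj₁ uP) (proj₁ uQ′)) b≤)
        (+-mono-≤ (*-monoˡ-≤ (*-nonneg (proj₁ uP′) (proj₁ uQ)) c≤)
          (+-mono-≤ (*-monoˡ-≤ (*-nonneg (proj₁ uP′) (proj₁ uQ′)) d≤) ≤-refl)))
    where
    uP′ = unit-complement uP
    uQ′ = unit-complement uQ

  branch-split : ∀ P Q c d → branch P Q c c d d ≈ P * c + (1# - P) * d
  branch-split = solve 4 (λ P Q c d → branchᴱ P Q c c d d := P :* c :+ (one :- P) :* d) ≡.refl

  branch-const : ∀ P Q c → branch P Q c c c c ≈ c
  branch-const = solve 3 (λ P Q c → branchᴱ P Q c c c c := c) ≡.refl

  -- The reflection (x , y) ↦ (-y , -x) reverses the sign of the centre: the moves of both agents up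
  -- and down trade places, while the approaching and the separating move are kept.
  branch-reflect : ∀ P Q a b c d → branch (1# - Q) (1# - P) a b c d ≈ branch P Q d b c a
  branch-reflect = solve 6 (λ P Q a b c d → branchᴱ (one :- Q) (one :- P) a b c d := branchᴱ P Q d b c a) ≡.refl

  branch-cong : ∀ {P P′ Q Q′} a b c d → P ≈ P′ → Q ≈ Q′ → branch P Q a b c d ≈ branch P′ Q′ a b c d
  branch-cong a b c d P≈ Q≈ =
    +-cong (*-congʳ (*-cong P≈ Q≈))
      (+-cong (*-congʳ (*-cong P≈ (+-congˡ (-‿cong Q≈))))
        (+-cong (*-congʳ (*-cong (+-congˡ (-‿cong P≈)) Q≈))
          (+-congʳ (*-congʳ (*-cong (+-congˡ (-‿cong P≈)) (+-congˡ (-‿cong Q≈)))))))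

  ½≈1-½ : ½ ≈ 1# - ½
  ½≈1-½ = trans (solve 1 (λ h → h := con 2 :* h :- h) ≡.refl ½) (+-congʳ 2½≈1)

  signed-reflect : ∀ {a} → a 0 ≈ ½ → ∀ x → signed a (ℤ.- x) ≈ 1# - signed a x
  signed-reflect a₀≈½ (+ zero)  = trans a₀≈½ (trans ½≈1-½ (+-congˡ (-‿cong (sym a₀≈½))))
  signed-reflect a₀≈½ (+ suc i) = refl
  signed-reflect {a} a₀≈½ -[1+ i ]  = solve 1 (λ x → x := one :- (one :- x)) ≡.refl (a (suc i))

  signed-unit : ∀ {a} → Admissible a → ∀ x → Unit (signed a x)
  signed-unit adm (+ i)    = proj₁ adm i
  signed-unit adm -[1+ i ] = unit-complement (proj₁ adm (suc i))

  -- The surplus is at least L (1 - 2P)².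
  diagonal-step : ∀ {L P a b c d} → 0# ≤ L → Unit P →
    fromℕ 5 * L ≤ a → 0# ≤ b → fromℕ 6 * L ≤ c → fromℕ 5 * L ≤ d → fromℕ 5 * L ≤ L + branch P P a b c d
  diagonal-step {L} {P} 0≤L uP 5L≤a 0≤b 6L≤c 5L≤d = ≤-trans
    (0≤y-x⇒x≤y (≤-resp refl
      (solve 2 (λ P L → L :* ((one :- con 2 :* P) :* (one :- con 2 :* P)) :=
        L :+ branchᴱ P P (con 5 :* L) (con 0) (con 6 :* L) (con 5 :* L) :- con 5 :* L) ≡.refl P L)
      (*-nonneg 0≤L (sq-nonneg (1# - fromℕ 2 * P)))))
    (+-monoʳ-≤ L (branch-mono uP uP 5L≤a 0≤b 6L≤c 5L≤d))

  module Walk {a : ℕ → Carrier} (adm : Admissible a) (K : Constants (a 1) (a 2)) where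

    open Constants K

    -- The value at x = n - j.  Where x ≥ 2, far′ weakens it so as to bound the states (n , n) as well.
    far far′ : ℤ → Carrier
    far (+ 0)                = m
    far (+ 1)                = h₁₃
    far (+ suc (suc _))      = fromℕ 6 * L
    far -[1+ 0 ]             = h₋₁₃
    far -[1+ suc _ ]         = L + v
    far′ (+ suc (suc _))     = fromℕ 5 * L
    far′ x                   = far x

    diagonal : ℕ → Carrier
    diagonal 0                   = α
    diagonal 1                   = u
    diagonal 2                   = h₂₂
    diagonal (suc (suc (suc _))) = fromℕ 5 * L

    -- The states (n - j , n + j); at (n , n) the agents are one step apart from meeting.
    H : ℕ → ℕ → Carrier
    H n             zero          = diagonal n
    H zero          (suc zero)    = v
    H (suc zero)    (suc zero)    = w
    H zero          (suc (suc j)) = L + v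
    H (suc zero)    (suc (suc j)) = far (1 ℤ.⊖ suc (suc j))
    H (suc (suc n)) (suc j)       = far (suc (suc n) ℤ.⊖ suc j)

    -- H₀ n k belongs to j = k - 1, so that k = 0 is the meeting.
    H₀ : ℕ → ℕ → Carrier
    H₀ n zero    = 0#
    H₀ n (suc j) = H n j

    5L≤6L : fromℕ 5 * L ≤ fromℕ 6 * L
    5L≤6L = 0≤y-x⇒x≤y (≤-resp refl (solve 1 (λ L → L := con 6 :* L :- con 5 :* L) ≡.refl L) (proj₁ 0<L))

    v≤L+v : v ≤ L + v
    v≤L+v = ≤-resp (+-identityˡ v) refl (+-monoˡ-≤ v (proj₁ 0<L))

    far′≤far : ∀ x → far′ x ≤ far x
    far′≤far (+ 0)           = ≤-refl
    far′≤far (+ 1)           = ≤-refl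
    far′≤far (+ suc (suc _)) = 5L≤6L
    far′≤far -[1+ _ ]        = ≤-refl

    5L≤far : ∀ x → fromℕ 5 * L ≤ far x
    5L≤far (+ 0)           = 5L≤m
    5L≤far (+ 1)           = 5L≤h₁₃
    5L≤far (+ suc (suc _)) = 5L≤6L
    5L≤far -[1+ 0 ]        = ≤-trans 5L≤v v≤h₋₁₃
    5L≤far -[1+ suc _ ]    = ≤-trans 5L≤v v≤L+v

    far≤M : ∀ x → far x ≤ M
    far≤M (+ 0)           = ≤-trans m≤w w≤M
    far≤M (+ 1)           = h₁₃≤M
    far≤M (+ suc (suc _)) = 6L≤M
    far≤M -[1+ 0 ]        = h₋₁₃≤M
    far≤M -[1+ suc _ ]    = L+v≤M

    H-elim : ∀ (P : Carrier → Set) → P α → P u → P h₂₂ → P (fromℕ 5 * L) → P v → P w → (∀ x → P (far x)) →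
      ∀ n j → P (H n j)
    H-elim P α′ u′ h′ l′ v′ w′ f′ 0 0 = α′
    H-elim P α′ u′ h′ l′ v′ w′ f′ 1 0 = u′
    H-elim P α′ u′ h′ l′ v′ w′ f′ 2 0 = h′
    H-elim P α′ u′ h′ l′ v′ w′ f′ (suc (suc (suc _))) 0 = l′
    H-elim P α′ u′ h′ l′ v′ w′ f′ 0 1 = v′
    H-elim P α′ u′ h′ l′ v′ w′ f′ 1 1 = w′
    H-elim P α′ u′ h′ l′ v′ w′ f′ 0 (suc (suc j)) = f′ -[1+ suc j ]
    H-elim P α′ u′ h′ l′ v′ w′ f′ 1 (suc (suc j)) = f′ (1 ℤ.⊖ suc (suc j))
    H-elim P α′ u′ h′ l′ v′ w′ f′ (suc (suc n)) (suc j) = f′ (suc (suc n) ℤ.⊖ suc j)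

    5L≤H : ∀ n j → fromℕ 5 * L ≤ H n j
    5L≤H = H-elim (fromℕ 5 * L ≤_) 5L≤α 5L≤u 5L≤h₂₂ ≤-refl 5L≤v (≤-trans 5L≤m m≤w) 5L≤far

    H≤M : ∀ n j → H n j ≤ M
    H≤M = H-elim (_≤ M) α≤M u≤M h₂₂≤M (≤-trans 5L≤6L 6L≤M) (≤-trans v≤L+v L+v≤M) w≤M far≤M

    -- Equality fails at most at (0 , 2), where the value is `w` in place of `m`.
    far≤H : ∀ n j → far (suc n ℤ.⊖ suc j) ≤ H (suc n) (suc j)
    far≤H zero    zero    = m≤w
    far≤H zero    (suc j) = ≤-refl
    far≤H (suc n) j       = ≤-refl

    5L≤far′ : ∀ x → fromℕ 5 * L ≤ far′ x
    5L≤far′ (+ 0)           = 5L≤far (+ 0)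
    5L≤far′ (+ 1)           = 5L≤far (+ 1)
    5L≤far′ (+ suc (suc _)) = ≤-refl
    5L≤far′ x@(-[1+ _ ])    = 5L≤far x

    v≤far′ : ∀ x → v ≤ far′ -[1+ x ]
    v≤far′ zero    = v≤h₋₁₃
    v≤far′ (suc x) = v≤L+v

    L+const-≤ : ∀ {P Q c a′ b′ c′ d′} → Unit P → Unit Q → c ≤ a′ → c ≤ b′ → c ≤ c′ → c ≤ d′ →
      L + c ≤ L + branch P Q a′ b′ c′ d′
    L+const-≤ {P} {Q} {c} uP uQ c≤a c≤b c≤c c≤d = +-monoʳ-≤ L (≤-trans
      (≤-reflexive (sym (branch-const P Q c))) (branch-mono uP uQ c≤a c≤b c≤c c≤d))

    far-step : ∀ x Q → Unit Q →
      far x ≤ L + branch (signed a x) Q (far′ (ℤ.suc x)) (far′ (ℤ.suc x)) (far′ (ℤ.pred x)) (far′ (ℤ.pred x))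
    far-step (+ 0) Q _ = ≤-trans m-step (≤-reflexive (+-congˡ (trans
      (+-cong (*-congʳ (sym (proj₂ adm))) (*-congʳ (+-congˡ (-‿cong (sym (proj₂ adm))))))
      (sym (branch-split (a 0) Q h₁₃ h₋₁₃)))))
    far-step (+ 1) Q _ = ≤-trans h₁₃-step (≤-reflexive (+-congˡ (sym (branch-split (a 1) Q _ m))))
    far-step x@(+ suc (suc k)) Q uQ = ≤-trans
      (≤-reflexive (solve 1 (λ L → con 6 :* L := L :+ con 5 :* L) ≡.refl L))
      (L+const-≤ (signed-unit adm x) uQ ≤-refl ≤-refl (5L≤far′ (+ suc k)) (5L≤far′ (+ suc k)))
    far-step -[1+ 0 ] Q _ = ≤-trans h₋₁₃-step (≤-reflexive (+-congˡ (sym (branch-split (1# - a 1) Q m _))))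
    far-step x@(-[1+ suc k ]) Q uQ =
      L+const-≤ (signed-unit adm x) uQ (v≤far′ k) (v≤far′ k) v≤L+v v≤L+v

    -- Centres are taken up to sign: from 0 the walk goes down to -1, which is represented by 1.
    down : ℕ → ℕ
    down n = ℤ.∣ ℤ.pred (+ n) ∣

    next : ℕ → ℕ → Carrier
    next n j = branch (signed a (n ℤ.⊖ j)) (a (n ℕ.+ j)) (H (suc n) j) (H₀ n j) (H n (suc j)) (H (down n) j)

    suc-⊖ : ∀ n j → ℤ.suc (n ℤ.⊖ j) ≡ suc n ℤ.⊖ j
    suc-⊖ n j = ℤ.distribʳ-⊖-+-pos 1 n j

    pred-⊖ : ∀ n j → ℤ.pred (n ℤ.⊖ j) ≡ n ℤ.⊖ suc j
    pred-⊖ n j = ℤ.distribʳ-⊖-+-neg 0 n j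

    far′≤H : ∀ {x} n j → x ≡ suc n ℤ.⊖ suc j → far′ x ≤ H (suc n) (suc j)
    far′≤H n j ≡.refl = ≤-trans (far′≤far (suc n ℤ.⊖ suc j)) (far≤H n j)

    -- The approaching move may reach the diagonal `j = 0`, and the move down may reach the centre
    -- 0; the bounds for these two are left as premises. The other two moves stay where `far′≤H`
    -- applies.
    far-next : ∀ n j → far′ (suc n ℤ.⊖ j) ≤ H (suc n) j → far′ (n ℤ.⊖ suc j) ≤ H n (suc j) →
      far (suc n ℤ.⊖ suc j) ≤ L + next (suc n) (suc j)
    far-next n j up≤ down≤ = ≤-trans (far-step x (a (suc n ℕ.+ suc j)) (proj₁ adm _))
      (+-monoʳ-≤ L (branch-mono (signed-unit adm x) (proj₁ adm _)
        (far′≤H (suc n) j (suc-⊖ (suc n) (suc j)))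
        (≤-trans (≤-reflexive (reflexive (≡.cong far′ (≡.trans (suc-⊖ (suc n) (suc j)) (ℤ.[1+m]⊖[1+n]≡m⊖n (suc n) j))))) up≤)
        (far′≤H n (suc j) (pred-⊖ (suc n) (suc j)))
        (≤-trans (≤-reflexive (reflexive (≡.cong far′ (≡.trans (pred-⊖ (suc n) (suc j)) (ℤ.[1+m]⊖[1+n]≡m⊖n n (suc j)))))) down≤)))
      where
      x = suc n ℤ.⊖ suc j

    node-step : ∀ n j → H n j ≤ L + next n j
    node-step 0 0 = ≤-trans α-step (≤-reflexive (+-congˡ (branch-cong _ _ _ _ (sym (proj₂ adm)) (sym (proj₂ adm)))))
    node-step 1 0 = u-step
    node-step 2 0 = h₂₂-step
    -- The neighbours have values `5 L`, `0`, `6 L` and at least `5 L`, as `diagonal-step` demands.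
    node-step n@(suc (suc (suc k))) 0 = ≤-trans
      (diagonal-step (proj₁ 0<L) (proj₁ adm n) ≤-refl ≤-refl ≤-refl (5L≤H (suc (suc k)) 0))
      (≤-reflexive (+-congˡ (branch-cong _ _ _ _ refl (reflexive (≡.cong a (≡.sym (ℕ.+-identityʳ n)))))))
    node-step 0 1 = v-step
    node-step 1 1 = ≤-trans w-step (≤-reflexive (+-congˡ (branch-cong _ _ _ _ (sym (proj₂ adm)) refl)))
    -- All neighbours have value at least `v`, and the value here is `L + v`.
    node-step 0 (suc (suc j)) = L+const-≤ (signed-unit adm -[1+ suc j ]) (proj₁ adm _)
      (v≤far j) (v≤H j) v≤L+v (v≤far j)
      where
      v≤far : ∀ j → v ≤ far (1 ℤ.⊖ suc (suc j))
      v≤far zero    = v≤h₋₁₃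
      v≤far (suc j) = v≤L+v
      v≤H : ∀ j → v ≤ H 0 (suc j)
      v≤H zero    = ≤-refl
      v≤H (suc j) = v≤L+v
    node-step 1 (suc (suc j)) = far-next 0 (suc j) (far′≤H 0 j ≡.refl) ≤-refl
    node-step (suc (suc n)) 1 = far-next (suc n) 0 (5L≤H (suc (suc n)) 0) (far′≤H n 0 ≡.refl)
    node-step (suc (suc n)) (suc (suc j)) = far-next (suc n) (suc j) (far′≤H (suc n) j ≡.refl) (far′≤H n (suc j) ≡.refl)

-- Coordinates by centre and separation.

-- (n - j , n + j) for j = k - 1.
position : ℤ → ℕ → ℤ × ℤ
position n k = ℤ.suc (n ℤ.- + k) , ℤ.pred (n ℤ.+ + k)

-- They recover `n` up to sign and `k` from `position n k`, since there `x + y = 2 n` and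
-- `y - x + 2 = 2 k`.
centre separation : ℤ × ℤ → ℕ
centre (x , y)     = ℕ.⌊ ℤ.∣ x ℤ.+ y ∣ /2⌋
separation (x , y) = ℕ.⌊ ℤ.∣ ℤ.suc (ℤ.suc (y ℤ.- x)) ∣ /2⌋

centre-position : ∀ n k → centre (position n k) ≡ ℤ.∣ n ∣
centre-position n k = ≡.trans
  (cong (λ i → ℕ.⌊ ℤ.∣ i ∣ /2⌋) (solveℤ 2 (λ n k → conℤ (+ 1) ⊕ (n ⊝ k) ⊕ (conℤ -[1+ 0 ] ⊕ (n ⊕ k)) ⊜ n ⊕ n) ≡.refl n (+ k)))
  (≡.trans (cong ℕ.⌊_/2⌋ (abs-double n)) (≡.sym (ℕ.n≡⌊n+n/2⌋ ℤ.∣ n ∣)))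
  where
  abs-double : ∀ n → ℤ.∣ n ℤ.+ n ∣ ≡ ℤ.∣ n ∣ ℕ.+ ℤ.∣ n ∣
  abs-double (+ n)    = ≡.refl
  abs-double -[1+ n ] = cong suc (≡.sym (ℕ.+-suc n n))

separation-position : ∀ n k → separation (position n k) ≡ k
separation-position n k = ≡.trans
  (cong (λ i → ℕ.⌊ ℤ.∣ i ∣ /2⌋) (solveℤ 2 (λ n k → conℤ (+ 1) ⊕ (conℤ (+ 1) ⊕ (conℤ -[1+ 0 ] ⊕ (n ⊕ k) ⊝ (conℤ (+ 1) ⊕ (n ⊝ k)))) ⊜ k ⊕ k) ≡.refl n (+ k)))
  (≡.sym (ℕ.n≡⌊n+n/2⌋ k))

separation-met : ∀ y → separation (y ℤ.+ + 2 , y) ≡ 0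
separation-met y = cong (λ i → ℕ.⌊ ℤ.∣ i ∣ /2⌋)
  (solveℤ 1 (λ y → conℤ (+ 1) ⊕ (conℤ (+ 1) ⊕ (y ⊝ (y ⊕ conℤ (+ 2)))) ⊜ conℤ (+ 0)) ≡.refl y)

module _ (n : ℤ) (j : ℕ) where

  private
    x = proj₁ (position n (suc j))
    y = proj₂ (position n (suc j))

  position-up : (ℤ.suc x , ℤ.suc y) ≡ position (ℤ.suc n) (suc j)
  position-up = cong₂ _,_
    (solveℤ 2 (λ n j → conℤ (+ 1) ⊕ (conℤ (+ 1) ⊕ (n ⊝ (conℤ (+ 1) ⊕ j))) ⊜ conℤ (+ 1) ⊕ (conℤ (+ 1) ⊕ n ⊝ (conℤ (+ 1) ⊕ j))) ≡.refl n (+ j))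
    (solveℤ 2 (λ n j → conℤ (+ 1) ⊕ (conℤ -[1+ 0 ] ⊕ (n ⊕ (conℤ (+ 1) ⊕ j))) ⊜ conℤ -[1+ 0 ] ⊕ (conℤ (+ 1) ⊕ n ⊕ (conℤ (+ 1) ⊕ j))) ≡.refl n (+ j))

  position-closer : (ℤ.suc x , ℤ.pred y) ≡ position n j
  position-closer = cong₂ _,_
    (solveℤ 2 (λ n j → conℤ (+ 1) ⊕ (conℤ (+ 1) ⊕ (n ⊝ (conℤ (+ 1) ⊕ j))) ⊜ conℤ (+ 1) ⊕ (n ⊝ j)) ≡.refl n (+ j))
    (solveℤ 2 (λ n j → conℤ -[1+ 0 ] ⊕ (conℤ -[1+ 0 ] ⊕ (n ⊕ (conℤ (+ 1) ⊕ j))) ⊜ conℤ -[1+ 0 ] ⊕ (n ⊕ j)) ≡.refl n (+ j))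

  position-farther : (ℤ.pred x , ℤ.suc y) ≡ position n (suc (suc j))
  position-farther = cong₂ _,_
    (solveℤ 2 (λ n j → conℤ -[1+ 0 ] ⊕ (conℤ (+ 1) ⊕ (n ⊝ (conℤ (+ 1) ⊕ j))) ⊜ conℤ (+ 1) ⊕ (n ⊝ (conℤ (+ 2) ⊕ j))) ≡.refl n (+ j))
    (solveℤ 2 (λ n j → conℤ (+ 1) ⊕ (conℤ -[1+ 0 ] ⊕ (n ⊕ (conℤ (+ 1) ⊕ j))) ⊜ conℤ -[1+ 0 ] ⊕ (n ⊕ (conℤ (+ 2) ⊕ j))) ≡.refl n (+ j))

  position-down : (ℤ.pred x , ℤ.pred y) ≡ position (ℤ.pred n) (suc j)
  position-down = cong₂ _,_
    (solveℤ 2 (λ n j → conℤ -[1+ 0 ] ⊕ (conℤ (+ 1) ⊕ (n ⊝ (conℤ (+ 1) ⊕ j))) ⊜ conℤ (+ 1) ⊕ (conℤ -[1+ 0 ] ⊕ n ⊝ (conℤ (+ 1) ⊕ j))) ≡.refl n (+ j))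
    (solveℤ 2 (λ n j → conℤ -[1+ 0 ] ⊕ (conℤ -[1+ 0 ] ⊕ (n ⊕ (conℤ (+ 1) ⊕ j))) ⊜ conℤ -[1+ 0 ] ⊕ (conℤ -[1+ 0 ] ⊕ n ⊕ (conℤ (+ 1) ⊕ j))) ≡.refl n (+ j))

  position-x : x ≡ n ℤ.- + j
  position-x = solveℤ 2 (λ n j → conℤ (+ 1) ⊕ (n ⊝ (conℤ (+ 1) ⊕ j)) ⊜ n ⊝ j) ≡.refl n (+ j)

  position-y : y ≡ n ℤ.+ + j
  position-y = solveℤ 2 (λ n j → conℤ -[1+ 0 ] ⊕ (n ⊕ (conℤ (+ 1) ⊕ j)) ⊜ n ⊕ j) ≡.refl n (+ j)

-- The lower bound for an arbitrary admissible strategy.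

module LatticeWalk (em : ExcludedMiddle 0ℓ) (ℝ : CompleteOrderedField) where

  open CompleteOrderedField ℝ
  open OrderedField ℝ
  open Polynomial ℝ
  open Rendezvous em ℝ
  open ExtendedReals em ℝ
  open Expectation
  open Potential em ℝ
  open Lattice em ℝ

  -- The pairs with `y - x` even and at least -2. The value -2, that is `k = 0`, is the meeting, so
  -- the agents cannot pass each other without meeting.
  OnLattice : ℤ × ℤ → Set
  OnLattice s = ∃₂ λ n k → s ≡ position n k

  met-position : ∀ n → Met 1 (position n 0)
  met-position n = solveℤ 1 (λ n → conℤ (+ 1) ⊕ (n ⊝ conℤ (+ 0)) ⊜ conℤ -[1+ 0 ] ⊕ (n ⊕ conℤ (+ 0)) ⊕ conℤ (+ 2)) ≡.refl n

  module States {a : ℕ → Carrier} (adm : Admissible a) (K : Constants (a 1) (a 2)) where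

    open Constants K
    open Walk adm K public

    -- The potential with the scaling by `L` undone. Off the lattice its values carry no meaning,
    -- but the bounds `0≤V` and `V≤M` hold there as well.
    V : ℤ × ℤ → Carrier
    V s = H₀ (centre s) (separation s) * L ⁻¹

    V-position : ∀ {s} n k → s ≡ position n k → V s ≡ H₀ ℤ.∣ n ∣ k * L ⁻¹
    V-position n k ≡.refl = cong₂ (λ i j → H₀ i j * L ⁻¹) (centre-position n k) (separation-position n k)

    V-met : ∀ {s} → Met 1 s → V s ≈ 0#
    V-met {_ , y} ≡.refl = trans (*-congʳ (reflexive (cong (H₀ (centre (y ℤ.+ + 2 , y))) (separation-met y)))) (zeroˡ _)

    branch-scale : ∀ P Q c d e f → branch P Q (c * L ⁻¹) (d * L ⁻¹) (e * L ⁻¹) (f * L ⁻¹) ≈ branch P Q c d e f * L ⁻¹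
    branch-scale P Q c d e f = solve 7 (λ P Q c d e f l →
      branchᴱ P Q (c :* l) (d :* l) (e :* l) (f :* l) := branchᴱ P Q c d e f :* l) ≡.refl P Q c d e f (L ⁻¹)

    expect-position : ∀ n j → expect (pairWalk a (position n (suc j))) V ≈ next ℤ.∣ n ∣ j * L ⁻¹
    expect-position n j = trans
      (trans
        (+-cong (*-congˡ (reflexive (V-position (ℤ.suc n) (suc j) (position-up n j))))
          (+-cong (*-congˡ (reflexive (V-position n j (position-closer n j))))
            (+-cong (*-congˡ (reflexive (V-position n (suc (suc j)) (position-farther n j))))
              (+-congʳ (*-congˡ (reflexive (V-position (ℤ.pred n) (suc j) (position-down n j))))))))
        (branch-scale _ _ _ _ _ _))
      (*-congʳ (trans
        (branch-cong _ _ _ _ (reflexive (cong (signed a) (position-x n j))) (reflexive (cong (signed a) (position-y n j))))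
        (weights n)))
      where
      weights : ∀ n →
        branch (signed a (n ℤ.- + j)) (signed a (n ℤ.+ + j))
          (H ℤ.∣ ℤ.suc n ∣ j) (H₀ ℤ.∣ n ∣ j) (H ℤ.∣ n ∣ (suc j)) (H ℤ.∣ ℤ.pred n ∣ j)
          ≈ next ℤ.∣ n ∣ j
      weights (+ n)    = branch-cong _ _ _ _ (reflexive (cong (signed a) (ℤ.m-n≡m⊖n n j))) refl
      -- At a negative centre the pair is (-y , -x) for the pair (x , y) at the opposite centre.
      -- Each probability is thus the complement of the other agent's, and `branch-reflect` restores
      -- the order.
      weights -[1+ n ] = trans
        (branch-cong _ _ _ _
          (trans (reflexive (cong (signed a) x≡)) (signed-reflect {a} (proj₂ adm) (+ (suc n ℕ.+ j))))
          (trans (reflexive (cong (signed a) y≡)) (signed-reflect {a} (proj₂ adm) (suc n ℤ.⊖ j))))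
        (trans (branch-reflect _ _ _ _ _ _) (reflexive (cong (λ i → branch (signed a (suc n ℤ.⊖ j)) (a (suc n ℕ.+ j))
          (H (suc (suc n)) j) (H₀ (suc n) j) (H (suc n) (suc j)) (H i j)) (abs-suc n))))
        where
        x≡ : -[1+ n ] ℤ.- + j ≡ ℤ.- (+ (suc n ℕ.+ j))
        x≡ = ≡.sym (ℤ.neg-distrib-+ (+ suc n) (+ j))
        y≡ : -[1+ n ] ℤ.+ + j ≡ ℤ.- (suc n ℤ.⊖ j)
        y≡ = ℤ.⊖-swap j (suc n)
        abs-suc : ∀ n → ℤ.∣ ℤ.suc -[1+ n ] ∣ ≡ n
        abs-suc zero    = ≡.refl
        abs-suc (suc n) = ≡.refl

    L*L⁻¹≈1 : L * L ⁻¹ ≈ 1#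
    L*L⁻¹≈1 = *-inverse-pos 0<L

    1+scale : ∀ x → (L + x) * L ⁻¹ ≈ 1# + x * L ⁻¹
    1+scale x = trans (distribʳ _ _ _) (+-congʳ L*L⁻¹≈1)

    on-lattice : ∀ {s} → OnLattice s → ¬ Met 1 s → All (λ (p , s′) → 0# ≤ p × (p ≈ 0# ⊎ OnLattice s′)) (pairWalk a s)
    on-lattice (n , zero  , ≡.refl) s∉T = contradiction (met-position n) s∉T
    on-lattice (n , suc j , ≡.refl) _   =
      (*-nonneg (proj₁ ux) (proj₁ uy) , inj₂ (ℤ.suc n , suc j , position-up n j)) ∷
      (*-nonneg (proj₁ ux) (proj₁ uy′) , inj₂ (n , j , position-closer n j)) ∷
      (*-nonneg (proj₁ ux′) (proj₁ uy) , inj₂ (n , suc (suc j) , position-farther n j)) ∷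
      (*-nonneg (proj₁ ux′) (proj₁ uy′) , inj₂ (ℤ.pred n , suc j , position-down n j)) ∷ []
      where
      ux = signed-unit adm (proj₁ (position n (suc j)))
      uy = signed-unit adm (proj₂ (position n (suc j)))
      ux′ = unit-complement ux
      uy′ = unit-complement uy

    total : ∀ s → expect (pairWalk a s) (λ _ → 1#) ≈ 1#
    total (x , y) = branch-const (signed a x) (signed a y) 1#

    V-step : ∀ {s} → OnLattice s → ¬ Met 1 s → V s ≤ 1# + expect (pairWalk a s) V
    V-step (n , zero  , ≡.refl) s∉T = contradiction (met-position n) s∉T
    V-step (n , suc j , ≡.refl) _   = ≤-resp
      (reflexive (≡.sym (V-position n (suc j) ≡.refl)))
      (trans (1+scale (next ℤ.∣ n ∣ j)) (+-congˡ (sym (expect-position n j))))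
      (*-monoʳ-≤ (⁻¹-pos 0<L) (node-step ℤ.∣ n ∣ j))

    0≤5L : 0# ≤ fromℕ 5 * L
    0≤5L = *-nonneg (fromℕ-nonneg 5) (proj₁ 0<L)

    0≤M : 0# ≤ M
    0≤M = ≤-trans 0≤5L (≤-trans 5L≤6L 6L≤M)

    V≤M : ∀ s → V s ≤ M * L ⁻¹
    V≤M s = *-monoʳ-≤ (⁻¹-pos 0<L) (H₀≤M (centre s) (separation s))
      where
      H₀≤M : ∀ n k → H₀ n k ≤ M
      H₀≤M n zero    = 0≤M
      H₀≤M n (suc j) = H≤M n j

    0≤V : ∀ s → 0# ≤ V s
    0≤V s = *-nonneg (0≤H₀ (centre s) (separation s)) (⁻¹-pos 0<L)
      where
      0≤H₀ : ∀ n k → 0# ≤ H₀ n k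
      0≤H₀ n zero    = ≤-refl
      0≤H₀ n (suc j) = ≤-trans 0≤5L (5L≤H n j)

    V≤𝔼[T] : fin (α * L ⁻¹) ≤∞ 𝔼[T] 1 a
    V≤𝔼[T] = ≤-expectedHittingTime {V = α * L ⁻¹} origin-on-lattice (*-nonneg 0≤M (⁻¹-pos 0<L))
      (λ N → ≤-stopped {V} (*-nonneg 0≤M (⁻¹-pos 0<L)) (λ {s} _ → V≤M s) (λ {s} _ s∈T → ≤-reflexive (V-met {s} s∈T)) V-step N origin-on-lattice)
      where
      open Chain (pairWalk a) (met? 1)
      open Closed {OnLattice} on-lattice (λ {s} _ _ → total s)
      origin-on-lattice : OnLattice (+ 0 , + 0)
      -- The origin has `j = 0`, hence `k = 1`.
      origin-on-lattice = + 0 , 1 , ≡.refl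

-- Assembling the constants for given first two parameters.

module Certified (em : ExcludedMiddle 0ℓ) (ℝ : CompleteOrderedField) where

  open CompleteOrderedField ℝ
  open OrderedField ℝ
  open Polynomial ℝ
  open Potential em ℝ
  open Lattice em ℝ

  module _ {t : Carrier} (isRoot : IsRoot t) {p r : Carrier} (0≤p≤1 : Unit p) (0≤r≤1 : Unit r) where

    open Bounds isRoot 0≤p≤1
    open Steps r

    private
      0≤q : 0# ≤ 1# - p
      0≤q = x≤y⇒0≤y-x (proj₂ 0≤p≤1)

      0≤5L : 0# ≤ fromℕ 5 * L
      0≤5L = *-nonneg (fromℕ-nonneg 5) 0≤L

      ≤-+ : ∀ {x y} → 0# ≤ y → x ≤ x + y
      ≤-+ 0≤y = ≤-trans (≤-reflexive (sym (+-identityʳ _))) (+-monoʳ-≤ _ 0≤y)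

      5≤6 : fromℕ 5 * L ≤ fromℕ 6 * L
      5≤6 = certify 6 (con 5 :* C.L) (con 6 :* C.L) ≡.refl

      15≤16 : fromℕ 15 * L ≤ fromℕ 16 * L
      15≤16 = certify 6 (con 15 :* C.L) (con 16 :* C.L) ≡.refl

      L+15L≤16L : L + fromℕ 15 * L ≤ fromℕ 16 * L
      L+15L≤16L = certify 6 (C.L :+ con 15 :* C.L) (con 16 :* C.L) ≡.refl

      5L≤15L : fromℕ 5 * L ≤ fromℕ 15 * L
      5L≤15L = certify 6 (con 5 :* C.L) (con 15 :* C.L) ≡.refl

      6L≤16L : fromℕ 6 * L ≤ fromℕ 16 * L
      6L≤16L = certify 6 (con 6 :* C.L) (con 16 :* C.L) ≡.refl

      w≤15L : w ≤ fromℕ 15 * L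
      w≤15L = ≤-trans (+-monoʳ-≤ m (≤-trans (*-monoʳ-≤ 0≤g (proj₂ 0≤r≤1)) (≤-reflexive (*-identityˡ g)))) m+g≤15L

      h₂₂≤16L : h₂₂ ≤ fromℕ 16 * L
      h₂₂≤16L = ≤-trans (+-monoʳ-≤ L (≤-trans
        (branch-mono 0≤r≤1 0≤r≤1 5L≤15L (≤-trans 0≤5L 5L≤15L) h₁₃≤15L u≤15L)
        (≤-reflexive (branch-const r r (fromℕ 15 * L))))) L+15L≤16L

    constants : Constants p r
    constants = record
      -- `h₂₂` and `L + v` are one step above values bounded by `15 L`, hence `16 L`.
      { L = L ; M = fromℕ 16 * L ; α = α ; u = u ; v = v ; m = m ; w = w ; h₂₂ = h₂₂ ; h₁₃ = h₁₃ ; h₋₁₃ = h₋₁₃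
      ; 0<L = fromℕ-pos 2992
      ; 5L≤α = 5L≤α ; 5L≤u = 5L≤u ; 5L≤v = 5L≤v ; 5L≤m = ≤-trans 5≤6 6L≤m
      ; 5L≤h₂₂ = diagonal-step 0≤L 0≤r≤1 ≤-refl ≤-refl 6L≤h₁₃ 5L≤u
      ; 5L≤h₁₃ = ≤-trans 5≤6 6L≤h₁₃
      ; v≤h₋₁₃ = v≤h₋₁₃
      ; m≤w = ≤-+ (*-nonneg (proj₁ 0≤r≤1) 0≤g)
      ; 6L≤M = 6L≤16L
      ; α≤M = ≤-trans α≤15L 15≤16 ; u≤M = ≤-trans u≤15L 15≤16 ; h₂₂≤M = h₂₂≤16L ; w≤M = ≤-trans w≤15L 15≤16
      ; h₁₃≤M = ≤-trans h₁₃≤15L 15≤16 ; h₋₁₃≤M = ≤-trans h₋₁₃≤15L 15≤16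
      ; L+v≤M = ≤-trans (+-monoʳ-≤ L v≤15L) L+15L≤16L
      ; α-step = ≤-reflexive (sym α-step)
      -- In the surplus, `r` occurs only through the product `y = p r`, which is nonnegative.
      ; u-step = ≤-trans (≤-+ (quadratic-part (p * r) (*-nonneg (proj₁ 0≤p≤1) (proj₁ 0≤r≤1)))) (≤-reflexive (sym u-step))
      ; v-step = ≤-trans (≤-+ (+-nonneg (*-nonneg (sq-nonneg (p - t)) 0≤c₂)
          (*-nonneg (*-nonneg (fromℕ-nonneg 2) (*-nonneg (proj₁ 0≤p≤1) 0≤q)) (*-nonneg (proj₁ 0≤r≤1) 0≤g))))
          (≤-reflexive (sym v-step))
      ; w-step = ≤-reflexive (sym w-step)
      ; m-step = ≤-trans (≤-+ 0≤g) (≤-reflexive (sym m-step))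
      ; h₂₂-step = ≤-refl
      ; h₁₃-step = ≤-reflexive (sym h₁₃-step)
      ; h₋₁₃-step = ≤-reflexive (sym h₋₁₃-step)
      }

-- Exact evaluation for the optimal strategy and for the truncated chain.

-- The positions visited with positive probability by the walk that turns back at distance 2.
data Core : ℤ → ℕ → Set where
  met₀   : Core (+ 0) 0
  met₁   : Core (+ 1) 0
  met₋₁  : Core -[1+ 0 ] 0
  core₀₁  : Core (+ 0) 1
  core₁₁  : Core (+ 1) 1
  core₋₁₁ : Core -[1+ 0 ] 1
  core₂₁  : Core (+ 2) 1
  core₋₂₁ : Core -[1+ 1 ] 1
  core₀₂  : Core (+ 0) 2
  core₁₂  : Core (+ 1) 2
  core₋₁₂ : Core -[1+ 0 ] 2
  core₀₃  : Core (+ 0) 3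

module Exact (em : ExcludedMiddle 0ℓ) (ℝ : CompleteOrderedField) where

  open CompleteOrderedField ℝ
  open OrderedField ℝ
  open Polynomial ℝ
  open Rendezvous em ℝ
  open ExtendedReals em ℝ
  open Expectation
  open Potential em ℝ
  open Lattice em ℝ
  open LatticeWalk em ℝ
  open Certified em ℝ

  OnCore : ℤ × ℤ → Set
  OnCore s = ∃₂ λ n k → Core n k × s ≡ position n k

  OnCore⇒IsState : ∀ {s} → OnCore s → IsState 1 2 s
  OnCore⇒IsState (_ , _ , met₀    , ≡.refl) = toWitness {a? = isState? 1 2 (position (+ 0) 0)} tt
  OnCore⇒IsState (_ , _ , met₁    , ≡.refl) = toWitness {a? = isState? 1 2 (position (+ 1) 0)} tt
  OnCore⇒IsState (_ , _ , met₋₁   , ≡.refl) = toWitness {a? = isState? 1 2 (position -[1+ 0 ] 0)} tt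
  OnCore⇒IsState (_ , _ , core₀₁  , ≡.refl) = toWitness {a? = isState? 1 2 (position (+ 0) 1)} tt
  OnCore⇒IsState (_ , _ , core₁₁  , ≡.refl) = toWitness {a? = isState? 1 2 (position (+ 1) 1)} tt
  OnCore⇒IsState (_ , _ , core₋₁₁ , ≡.refl) = toWitness {a? = isState? 1 2 (position -[1+ 0 ] 1)} tt
  OnCore⇒IsState (_ , _ , core₂₁  , ≡.refl) = toWitness {a? = isState? 1 2 (position (+ 2) 1)} tt
  OnCore⇒IsState (_ , _ , core₋₂₁ , ≡.refl) = toWitness {a? = isState? 1 2 (position -[1+ 1 ] 1)} tt
  OnCore⇒IsState (_ , _ , core₀₂  , ≡.refl) = toWitness {a? = isState? 1 2 (position (+ 0) 2)} tt
  OnCore⇒IsState (_ , _ , core₁₂  , ≡.refl) = toWitness {a? = isState? 1 2 (position (+ 1) 2)} tt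
  OnCore⇒IsState (_ , _ , core₋₁₂ , ≡.refl) = toWitness {a? = isState? 1 2 (position -[1+ 0 ] 2)} tt
  OnCore⇒IsState (_ , _ , core₀₃  , ≡.refl) = toWitness {a? = isState? 1 2 (position (+ 0) 3)} tt

  module Truncation (d n : ℕ) where

    inject : Carrier × (ℤ × ℤ) → Maybe (Carrier × State d n)
    inject (p , z) = Maybe.map (λ z∈ → p , z , z∈) (dec⇒maybe (isState? d n z))

    truncatedStep-walk : ∀ as {s} → ¬ Absorbing d n s →
      truncatedStep d n as s ≡ mapMaybe inject (pairWalk (extend as) (proj₁ s))
    truncatedStep-walk as {s} s∉T with absorbing? d n s
    ... | yes s∈T = contradiction s∈T s∉T
    ... | no  _   = ≡.refl

    -- The outcomes that `mapMaybe inject` discards lie outside the state space, so by hypothesis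
    -- they have weight zero.
    expect-inject : ∀ {μ f} → All (λ (p , z) → p ≈ 0# ⊎ IsState d n z) μ →
      expect (mapMaybe inject μ) (f ∘ proj₁) ≈ expect μ f
    expect-inject {[]} [] = refl
    expect-inject {(p , z) ∷ μ} {f} (h ∷ hs) with isState? d n z | h
    ... | yes _  | _         = +-congˡ (expect-inject hs)
    ... | no  z∉ | inj₂ z∈   = contradiction z∈ z∉
    ... | no  _  | inj₁ p≈0  = trans (expect-inject hs)
      (sym (trans (+-congʳ (trans (*-congʳ p≈0) (zeroˡ (f z)))) (+-identityˡ _)))

    all-inject : ∀ {μ} {Q : Carrier → ℤ × ℤ → Set} → All (λ (p , z) → Q p z) μ →
      All (λ (p , s) → Q p (proj₁ s)) (mapMaybe inject μ)
    all-inject {[]} [] = []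
    all-inject {(p , z) ∷ μ} (h ∷ hs) with isState? d n z
    ... | yes _ = h ∷ all-inject hs
    ... | no  _ = all-inject hs

  module _ {t : Carrier} (isRoot : IsRoot t) (0≤t≤1 : Unit t) where

    strategy : ℕ → Carrier
    strategy = extend (t ∷ [])

    admissible : Admissible strategy
    admissible = (λ { 0 → unit-½ ; 1 → 0≤t≤1 ; (suc (suc i)) → ≤-refl , 0≤1 }) , refl

    K : Constants t 0#
    K = constants isRoot 0≤t≤1 (≤-refl , 0≤1)

    open Constants K using (L; M; α; u; v; m; w; h₂₂; h₁₃; h₋₁₃; 0<L)
    open States admissible K
    private
      module B = Bounds isRoot 0≤t≤1
      module S = B.Steps 0#

    core-step : ∀ {n j} → Core n (suc j) → H ℤ.∣ n ∣ j ≈ L + next ℤ.∣ n ∣ j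
    core-step core₀₁  = sym S.α-step
    core-step core₁₁  = exact-u
      where
      exact-u : u ≈ L + branch t t h₂₂ 0# w α
      exact-u = sym (trans S.u-step (trans
        (+-congˡ (solve 4 (λ t c b a → (t :- t) :* (t :- t) :* c :+ t :* con 0 :* b :+ t :* con 0 :* (t :* con 0) :* a := con 0)
          ≡.refl t (⟦ B.C.c₁ ⟧ B.ρ) B.B B.A)) (+-identityʳ u)))
    core-step core₋₁₁ = core-step core₁₁
    -- `h₂₂` is defined by its own step equation.
    core-step core₂₁  = refl
    core-step core₋₂₁ = refl
    core-step core₀₂  = sym (trans S.v-step (trans
        (+-congˡ (solve 3 (λ t c g → (t :- t) :* (t :- t) :* c :+ con 2 :* (t :* (one :- t)) :* (con 0 :* g) := con 0)
          ≡.refl t (⟦ B.C.c₂ ⟧ B.ρ) B.g)) (+-identityʳ v)))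
    core-step core₁₂  = sym S.w-step
    core-step core₋₁₂ = sym S.w-step
    -- At (-2 , 2) both agents turn back with certainty, so (-1 , 1) is the only successor.
    core-step core₀₃  = +-congˡ (sym (solve 4 (λ a b c d → branchᴱ (one :- con 0) (con 0) a b c d := b) ≡.refl _ _ _ _))

    private
      unit-signed : ∀ x → Unit (signed strategy x)
      unit-signed = signed-unit admissible

      1-[1-0]≈0 : 1# - (1# - 0#) ≈ 0#
      1-[1-0]≈0 = solve 0 (one :- (one :- con 0) := con 0) ≡.refl

      Outcome : Carrier × (ℤ × ℤ) → Set
      Outcome (p , s) = 0# ≤ p × (p ≈ 0# ⊎ OnCore s)

      outcomes : ∀ n j → let x , y = position n (suc j); P = signed strategy x; Q = signed strategy y in
        (P * Q ≈ 0# ⊎ Core (ℤ.suc n) (suc j)) → (P * (1# - Q) ≈ 0# ⊎ Core n j) →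
        ((1# - P) * Q ≈ 0# ⊎ Core n (suc (suc j))) → ((1# - P) * (1# - Q) ≈ 0# ⊎ Core (ℤ.pred n) (suc j)) →
        All Outcome (pairWalk strategy (position n (suc j)))
      outcomes n j up closer farther down =
        (*-nonneg (proj₁ uP) (proj₁ uQ)   , at (ℤ.suc n) (suc j) up (position-up n j)) ∷
        (*-nonneg (proj₁ uP) (proj₁ uQ′)  , at n j closer (position-closer n j)) ∷
        (*-nonneg (proj₁ uP′) (proj₁ uQ)  , at n (suc (suc j)) farther (position-farther n j)) ∷
        (*-nonneg (proj₁ uP′) (proj₁ uQ′) , at (ℤ.pred n) (suc j) down (position-down n j)) ∷ []
        where
        uP = unit-signed (proj₁ (position n (suc j)))
        uQ = unit-signed (proj₂ (position n (suc j)))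
        uP′ = unit-complement uP
        uQ′ = unit-complement uQ
        at : ∀ {p s} n k → p ≈ 0# ⊎ Core n k → s ≡ position n k → p ≈ 0# ⊎ OnCore s
        at n k (inj₁ p≈0) _  = inj₁ p≈0
        at n k (inj₂ c)   eq = inj₂ (n , k , c , eq)

    -- A move out of the core requires an agent at distance 2 from its start to go further out,
    -- which has probability zero because `a₂ = 0`.
    on-core : ∀ {s} → OnCore s → ¬ Met 1 s → All Outcome (pairWalk strategy s)
    on-core (_ , _ , met₀    , ≡.refl) s∉T = contradiction (met-position (+ 0)) s∉T
    on-core (_ , _ , met₁    , ≡.refl) s∉T = contradiction (met-position (+ 1)) s∉T
    on-core (_ , _ , met₋₁   , ≡.refl) s∉T = contradiction (met-position -[1+ 0 ]) s∉T
    on-core (_ , _ , core₀₁  , ≡.refl) _ =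
      outcomes (+ 0) 0 (inj₂ core₁₁) (inj₂ met₀) (inj₂ core₀₂) (inj₂ core₋₁₁)
    on-core (_ , _ , core₁₁  , ≡.refl) _ =
      outcomes (+ 1) 0 (inj₂ core₂₁) (inj₂ met₁) (inj₂ core₁₂) (inj₂ core₀₁)
    on-core (_ , _ , core₋₁₁ , ≡.refl) _ =
      outcomes -[1+ 0 ] 0 (inj₂ core₀₁) (inj₂ met₋₁) (inj₂ core₋₁₂) (inj₂ core₋₂₁)
    on-core (_ , _ , core₂₁  , ≡.refl) _ =
      outcomes (+ 2) 0 (inj₁ (zeroˡ _)) (inj₁ (zeroˡ _)) (inj₁ (zeroʳ _)) (inj₂ core₁₁)
    on-core (_ , _ , core₋₂₁ , ≡.refl) _ =
      outcomes -[1+ 1 ] 0 (inj₂ core₋₁₁) (inj₁ (trans (*-congˡ 1-[1-0]≈0) (zeroʳ _)))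
        (inj₁ (trans (*-congʳ 1-[1-0]≈0) (zeroˡ _))) (inj₁ (trans (*-congʳ 1-[1-0]≈0) (zeroˡ _)))
    on-core (_ , _ , core₀₂  , ≡.refl) _ =
      outcomes (+ 0) 1 (inj₂ core₁₂) (inj₂ core₀₁) (inj₂ core₀₃) (inj₂ core₋₁₂)
    on-core (_ , _ , core₁₂  , ≡.refl) _ =
      outcomes (+ 1) 1 (inj₁ (zeroʳ _)) (inj₂ core₁₁) (inj₁ (zeroʳ _)) (inj₂ core₀₂)
    on-core (_ , _ , core₋₁₂ , ≡.refl) _ =
      outcomes -[1+ 0 ] 1 (inj₂ core₀₂) (inj₂ core₋₁₁)
        (inj₁ (trans (*-congʳ 1-[1-0]≈0) (zeroˡ _))) (inj₁ (trans (*-congʳ 1-[1-0]≈0) (zeroˡ _)))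
    on-core (_ , _ , core₀₃  , ≡.refl) _ =
      outcomes (+ 0) 2 (inj₁ (zeroʳ _)) (inj₂ core₀₂) (inj₁ (zeroʳ _)) (inj₁ (trans (*-congʳ 1-[1-0]≈0) (zeroˡ _)))

    V-core : ∀ {s} → OnCore s → ¬ Met 1 s → V s ≈ 1# + expect (pairWalk strategy s) V
    V-core (_ , _ , met₀  , ≡.refl) s∉T = contradiction (met-position (+ 0)) s∉T
    V-core (_ , _ , met₁  , ≡.refl) s∉T = contradiction (met-position (+ 1)) s∉T
    V-core (_ , _ , met₋₁ , ≡.refl) s∉T = contradiction (met-position -[1+ 0 ]) s∉T
    V-core (n , suc j , c , ≡.refl) _   = trans (reflexive (V-position n (suc j) ≡.refl))
      (trans (*-congʳ (core-step c)) (trans (1+scale (next ℤ.∣ n ∣ j)) (+-congˡ (sym (expect-position n j)))))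

    private
      0≤M′ : 0# ≤ M * L ⁻¹
      0≤M′ = *-nonneg 0≤M (⁻¹-pos 0<L)

      origin-on-core : OnCore (+ 0 , + 0)
      origin-on-core = + 0 , 1 , core₀₁ , ≡.refl

    𝔼[T]≈ : 𝔼[T] 1 strategy ≈∞ fin (α * L ⁻¹)
    𝔼[T]≈ = expectedHittingTime-≈ {V} 0≤M′ 0≤V V≤M (λ {s} s∈T → V-met {s} s∈T) V-core origin-on-core
      where
      open Chain (pairWalk strategy) (met? 1)
      open Closed {OnCore} on-core (λ {s} _ _ → total s)

    -- On the core the truncated chain has the expectations of the walk, so `V` composed with
    -- `proj₁` satisfies its step equation.
    U≈ : U 1 2 (t ∷ []) ≈∞ fin (α * L ⁻¹)
    U≈ = expectedHittingTime-≈ {λ s → V (proj₁ s)} 0≤M′ (λ s → 0≤V (proj₁ s)) (λ s → V≤M (proj₁ s))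
      (λ {s} s∈T → V-met {proj₁ s} (absorbing⇒met s s∈T))
      (λ {s} c s∉T → trans (V-core c (not-met s s∉T)) (+-congˡ (sym (expect-truncated s c s∉T V)))) origin-on-core
      where
      open Truncation 1 2
      absorbing⇒met : ∀ s → Absorbing 1 2 s → Met 1 (proj₁ s)
      absorbing⇒met ((x , y) , _) x-y≡2 = ≡.trans (solveℤ 2 (λ x y → x ⊜ x ⊝ y ⊕ y) ≡.refl x y) (≡.trans (cong (ℤ._+ y) x-y≡2) (ℤ.+-comm (+ 2) y))
      not-met : ∀ s → ¬ Absorbing 1 2 s → ¬ Met 1 (proj₁ s)
      not-met ((_ , y) , _) s∉T ≡.refl = s∉T (solveℤ 1 (λ y → y ⊕ conℤ (+ 2) ⊝ y ⊜ conℤ (+ 2)) ≡.refl y)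
      walk-in-range : ∀ s → OnCore (proj₁ s) → ¬ Absorbing 1 2 s →
        All (λ (p , z) → p ≈ 0# ⊎ IsState 1 2 z) (pairWalk strategy (proj₁ s))
      walk-in-range s c s∉T = All.map (λ { (_ , inj₁ p≈0) → inj₁ p≈0 ; (_ , inj₂ c) → inj₂ (OnCore⇒IsState c) })
        (on-core c (not-met s s∉T))
      expect-truncated : ∀ s → OnCore (proj₁ s) → ¬ Absorbing 1 2 s → ∀ f →
        expect (truncatedStep 1 2 (t ∷ []) s) (f ∘ proj₁) ≈ expect (pairWalk strategy (proj₁ s)) f
      expect-truncated s c s∉T f = trans
        (reflexive (cong (λ μ → expect μ (f ∘ proj₁)) (truncatedStep-walk (t ∷ []) {s} s∉T)))
        (expect-inject (walk-in-range s c s∉T))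
      open Chain (truncatedStep 1 2 (t ∷ [])) (absorbing? 1 2)
      open Closed {λ s → OnCore (proj₁ s)}
        (λ {s} c s∉T → ≡.subst (All (λ (p , s′) → 0# ≤ p × (p ≈ 0# ⊎ OnCore (proj₁ s′))))
          (≡.sym (truncatedStep-walk (t ∷ []) {s} s∉T))
          (all-inject {Q = λ p z → 0# ≤ p × (p ≈ 0# ⊎ OnCore z)} (on-core c (not-met s s∉T))))
        (λ {s} c s∉T → trans (expect-truncated s c s∉T (λ _ → 1#)) (total (proj₁ s)))

-- Existence and uniqueness of the root of the quartic.

module QuarticRoot (em : ExcludedMiddle 0ℓ) (ℝ : CompleteOrderedField) where

  open CompleteOrderedField ℝ
  open OrderedField ℝ
  open Polynomial ℝ
  open Rendezvous em ℝ
  open Potential em ℝ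

  prove-unit : (e : Expr 2) → nonneg? 1 0 (normalise e) ≡ true → ∀ {x y} → Unit x → Unit y → 0# ≤ ⟦ e ⟧ (x ∷ y ∷ [])
  prove-unit e eq ux uy = ≤-resp refl (normalise-correct e _) (nonneg?-sound 1 0 (normalise e) eq (ux ∷ uy ∷ []))

  private
    -- The divided difference of the quartic at `x` and `y`. Its bounds 40 and 200 on the unit
    -- square give strict monotonicity and a Lipschitz constant.
    slopeᴱ : Expr 2
    slopeᴱ = con 52 :+ con 39 :* (x :+ y) :+ con 12 :* (x :* x :+ x :* y :+ y :* y)
      :- con 3 :* (x :* x :* x :+ x :* x :* y :+ x :* y :* y :+ y :* y :* y)
      where
      x = var 0F
      y = var 1F

  quartic-increasing : ∀ {x y} → Unit x → Unit y → x ≤ y → fromℕ 40 * (y - x) ≤ quartic y - quartic x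
  quartic-increasing {x} {y} ux uy x≤y = 0≤y-x⇒x≤y (≤-resp refl
    (prove {2} ((var 1F :- var 0F) :* (slopeᴱ :- con 40))
      (quarticᴱ (var 1F) :- quarticᴱ (var 0F) :- con 40 :* (var 1F :- var 0F)) ≡.refl (x ∷ y ∷ []))
    (*-nonneg (x≤y⇒0≤y-x x≤y) (prove-unit (slopeᴱ :- con 40) ≡.refl ux uy)))

  quartic-lipschitz : ∀ {x y} → Unit x → Unit y → x ≤ y → quartic y - quartic x ≤ fromℕ 200 * (y - x)
  quartic-lipschitz {x} {y} ux uy x≤y = 0≤y-x⇒x≤y (≤-resp refl
    (prove {2} ((var 1F :- var 0F) :* (con 200 :- slopeᴱ))
      (con 200 :* (var 1F :- var 0F) :- (quarticᴱ (var 1F) :- quarticᴱ (var 0F))) ≡.refl (x ∷ y ∷ []))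
    (*-nonneg (x≤y⇒0≤y-x x≤y) (prove-unit (con 200 :- slopeᴱ) ≡.refl ux uy)))

  quartic-root-≤ : ∀ {x y} → Unit x → Unit y → quartic x ≈ 0# → quartic y ≈ 0# → x ≤ y → y ≤ x
  quartic-root-≤ {x} {y} ux uy qx≈0 qy≈0 x≤y = 0≤y-x⇒x≤y (≤-resp refl
    (solve 2 (λ x y → :- (y :- x) := x :- y) ≡.refl x y)
    (x≤0⇒0≤-x (*-cancelˡ-≤ (fromℕ-pos 40) (≤-trans (quartic-increasing ux uy x≤y)
      (≤-reflexive (trans (+-cong qy≈0 (-‿cong qx≈0)) (trans (-‿inverseʳ 0#) (sym (zeroʳ _)))))))))

  quartic-root-unique : ∀ {x y} → Unit x → Unit y → quartic x ≈ 0# → quartic y ≈ 0# → x ≈ y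
  quartic-root-unique {x} {y} ux uy qx≈0 qy≈0 =
    [ (λ x≤y → ≤-antisym x≤y (quartic-root-≤ ux uy qx≈0 qy≈0 x≤y))
    , (λ y≤x → ≤-antisym (quartic-root-≤ uy ux qy≈0 qx≈0 y≤x) y≤x) ]′ (≤-total x y)

  -- The least upper bound t of Below satisfies t ≤ t - f t / 200, and then t - f t / 200 lies in Below.
  module _ {lo hi : Carrier} (u-lo : Unit lo) (u-hi : Unit hi) (lo≤hi : lo ≤ hi)
           (q-lo : quartic lo ≤ 0#) (q-hi : 0# ≤ quartic hi) where

    private
      Below : Carrier → Set
      Below x = lo ≤ x × x ≤ hi × quartic x ≤ 0#

      ι : Carrier
      ι = fromℕ 200 ⁻¹

      0≤ι : 0# ≤ ι
      0≤ι = ⁻¹-pos (fromℕ-pos 200)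

      200ι≈1 : fromℕ 200 * ι ≈ 1#
      200ι≈1 = *-inverse-pos (fromℕ-pos 200)

      sup : ∃ (IsLeastUpperBound Below)
      sup = complete Below (lo , ≤-refl , lo≤hi , q-lo) (hi , λ x (_ , x≤hi , _) → x≤hi)

      t = proj₁ sup

      upper : UpperBound Below t
      upper = proj₁ (proj₂ sup)

      least : ∀ v → UpperBound Below v → t ≤ v
      least = proj₂ (proj₂ sup)

      lo≤t : lo ≤ t
      lo≤t = upper lo (≤-refl , lo≤hi , q-lo)

      t≤hi : t ≤ hi
      t≤hi = least hi (λ x (_ , x≤hi , _) → x≤hi)

      between : ∀ {x} → lo ≤ x → x ≤ hi → Unit x
      between lo≤x x≤hi = ≤-trans (proj₁ u-lo) lo≤x , ≤-trans x≤hi (proj₂ u-hi)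

      ut = between lo≤t t≤hi

      scale-ι : ∀ {a b} → a ≤ fromℕ 200 * b → a * ι ≤ b
      scale-ι {a} {b} a≤200b = ≤-trans (*-monoʳ-≤ 0≤ι a≤200b) (≤-reflexive (trans
        (solve 3 (λ c b i → c :* b :* i := b :* (c :* i)) ≡.refl (fromℕ 200) b ι)
        (trans (*-congˡ 200ι≈1) (*-identityʳ b))))

      unscale-ι : ∀ {a} → a * ι ≤ 0# → a ≤ 0#
      unscale-ι {a} aι≤0 = ≤-resp
        (trans (solve 3 (λ c a i → c :* (a :* i) := a :* (c :* i)) ≡.refl (fromℕ 200) a ι)
          (trans (*-congˡ 200ι≈1) (*-identityʳ a)))
        (zeroʳ _) (*-monoˡ-≤ (fromℕ-nonneg 200) aι≤0)

      cancel-+ : ∀ {x y} → x ≤ x - y → y ≤ 0#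
      cancel-+ {x} {y} x≤x-y = 0≤y-x⇒x≤y (≤-resp refl
        (solve 2 (λ x y → x :- y :- x := con 0 :- y) ≡.refl x y) (x≤y⇒0≤y-x x≤x-y))

      q-t≤0 : quartic t ≤ 0#
      q-t≤0 = unscale-ι (cancel-+ (least (t - quartic t * ι) λ x below → 0≤y-x⇒x≤y (≤-resp refl
        (solve 3 (λ t x y → t :- x :- y := t :- y :- x) ≡.refl t x (quartic t * ι))
        (x≤y⇒0≤y-x (scale-ι (≤-trans (below-bound (proj₂ (proj₂ below)))
          (quartic-lipschitz (between (proj₁ below) (proj₁ (proj₂ below))) ut (upper x below))))))))
        where
        below-bound : ∀ {a b} → b ≤ 0# → a ≤ a - b
        below-bound {a} b≤0 = ≤-resp (+-identityʳ a) refl (+-monoʳ-≤ a (x≤0⇒0≤-x b≤0))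

      0≤q-t : 0# ≤ quartic t
      0≤q-t = 0≤y-x⇒x≤y (≤-resp refl
        (solve 1 (λ q → :- (:- q) := q :- con 0) ≡.refl (quartic t))
        (x≤0⇒0≤-x (unscale-ι δ≤0)))
        where
        δ = - quartic t * ι
        0≤δ : 0# ≤ δ
        0≤δ = *-nonneg (x≤0⇒0≤-x q-t≤0) 0≤ι
        t≤t+δ : t ≤ t + δ
        t≤t+δ = ≤-resp (+-identityʳ t) refl (+-monoʳ-≤ t 0≤δ)
        -q-t≤ : - quartic t ≤ quartic hi - quartic t
        -q-t≤ = ≤-resp (+-identityˡ _) refl (+-monoˡ-≤ (- quartic t) q-hi)
        t+δ≤hi : t + δ ≤ hi
        t+δ≤hi = ≤-resp refl (solve 2 (λ t h → t :+ (h :- t) := h) ≡.refl t hi)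
          (+-monoʳ-≤ t (scale-ι (≤-trans -q-t≤ (quartic-lipschitz ut u-hi t≤hi))))
        q-t+δ≤0 : quartic (t + δ) ≤ 0#
        q-t+δ≤0 = 0≤y-x⇒x≤y (≤-resp refl
          (trans (+-congʳ (trans (solve 4 (λ c t q i → c :* (t :+ :- q :* i :- t) := :- q :* (c :* i))
              ≡.refl (fromℕ 200) t (quartic t) ι) (trans (*-congˡ 200ι≈1) (*-identityʳ _))))
            (solve 2 (λ q r → :- q :- (r :- q) := con 0 :- r) ≡.refl (quartic t) (quartic (t + δ))))
          (x≤y⇒0≤y-x (quartic-lipschitz ut (between (≤-trans lo≤t t≤t+δ) t+δ≤hi) t≤t+δ)))
        δ≤0 : δ ≤ 0#
        δ≤0 = 0≤y-x⇒x≤y (≤-resp refl (solve 2 (λ t d → t :- (t :+ d) := con 0 :- d) ≡.refl t δ)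
          (x≤y⇒0≤y-x (upper (t + δ) (≤-trans lo≤t t≤t+δ , t+δ≤hi , q-t+δ≤0))))

    quartic-root : ∃ λ t → lo ≤ t × t ≤ hi × quartic t ≈ 0#
    quartic-root = t , lo≤t , t≤hi , ≤-antisym q-t≤0 0≤q-t

-- Locating the root, decimal approximations, and the infimum.

module Optimum (em : ExcludedMiddle 0ℓ) (ℝ : CompleteOrderedField) where

  open CompleteOrderedField ℝ
  open OrderedField ℝ
  open Polynomial ℝ
  open Rendezvous em ℝ
  open ExtendedReals em ℝ
  open Potential em ℝ
  open Lattice em ℝ
  open LatticeWalk em ℝ
  open Certified em ℝ
  open Exact em ℝ
  open QuarticRoot em ℝ

  private
    unit-0 : Unit 0#
    unit-0 = ≤-refl , 0≤1

    grid : ℕ → Carrier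
    grid k = fromℕ k * fromℕ rootScale ⁻¹

    scale-grid : ∀ k → fromℕ rootScale * grid k ≈ fromℕ k
    scale-grid k = trans
      (solve 3 (λ s k i → s :* (k :* i) := k :* (s :* i)) ≡.refl (fromℕ rootScale) (fromℕ k) (fromℕ rootScale ⁻¹))
      (trans (*-congˡ (*-inverse-pos (fromℕ-pos rootScale))) (*-identityʳ _))

    fromℕ-≤-suc : ∀ k → fromℕ k ≤ fromℕ (suc k)
    fromℕ-≤-suc k = ≤-resp (+-identityˡ _) refl (+-monoˡ-≤ (fromℕ k) 0≤1)

    InCell : ℕ → Carrier → Set
    InCell l x = fromℕ l ≤ fromℕ rootScale * x × fromℕ rootScale * x ≤ fromℕ (suc l)

    cell-left : ∀ l → InCell l (grid l)
    cell-left l = ≤-reflexive (sym (scale-grid l)) , ≤-trans (≤-reflexive (scale-grid l)) (fromℕ-≤-suc l)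

    cell-right : ∀ l → InCell l (grid (suc l))
    cell-right l = ≤-trans (fromℕ-≤-suc l) (≤-reflexive (sym (scale-grid (suc l)))) , ≤-reflexive (scale-grid (suc l))

    -- For expressions in the first variable only; the second variable is set to `0#`.
    in-cell : ∀ l {x} → InCell l x → (e : Expr 2) →
      nonneg? 1 0 (swap 0 (zoom 1 rootScale l (normalise e))) ≡ true → 0# ≤ ⟦ e ⟧ (x ∷ 0# ∷ [])
    in-cell l (l≤ , ≤l) e eq = prove-nonneg rootScale l 0 e eq l≤ ≤l unit-0

    lo hi : Carrier
    lo = grid rootNumerator
    hi = grid (suc rootNumerator)

    lo≤hi : lo ≤ hi
    lo≤hi = *-monoʳ-≤ (⁻¹-pos (fromℕ-pos rootScale)) (fromℕ-≤-suc rootNumerator)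

    -- The sign is read off outside the cell of the root: `lo` is the right end of the preceding
    -- cell, on all of which the quartic is nonpositive. Likewise `hi` is the left end of the
    -- following cell.
    q-lo : quartic lo ≤ 0#
    q-lo = 0≤y-x⇒x≤y (≤-trans
      (in-cell (ℕ.pred rootNumerator) (cell-right (ℕ.pred rootNumerator)) (con 0 :- quarticᴱ (var 0F)) ≡.refl) ≤-refl)

    q-hi : 0# ≤ quartic hi
    q-hi = in-cell (suc rootNumerator) (cell-left (suc rootNumerator)) (quarticᴱ (var 0F)) ≡.refl

    cell-unit : ∀ {x} → InCell rootNumerator x → Unit x
    cell-unit c = in-cell rootNumerator c (var 0F) ≡.refl , 0≤y-x⇒x≤y (in-cell rootNumerator c (one :- var 0F) ≡.refl)

    root : ∃ λ t → lo ≤ t × t ≤ hi × quartic t ≈ 0#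
    root = quartic-root (cell-unit (cell-left rootNumerator)) (cell-unit (cell-right rootNumerator)) lo≤hi q-lo q-hi

  a* : Carrier
  a* = proj₁ root

  private
    a*-cell : InCell rootNumerator a*
    a*-cell =
        ≤-trans (≤-reflexive (sym (scale-grid rootNumerator))) (*-monoˡ-≤ (fromℕ-nonneg rootScale) (proj₁ (proj₂ root)))
      , ≤-trans (*-monoˡ-≤ (fromℕ-nonneg rootScale) (proj₁ (proj₂ (proj₂ root)))) (≤-reflexive (scale-grid (suc rootNumerator)))

  isRoot : IsRoot a*
  isRoot = proj₁ a*-cell , proj₂ a*-cell , proj₂ (proj₂ (proj₂ root))

  0≤a*≤1 : Unit a*
  0≤a*≤1 = cell-unit a*-cell

  0<a* : 0# < a*
  0<a* = ≰⇒> λ a*≤0 → 0≉1 (≤-antisym 0≤1 (≤-trans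
    (0≤y-x⇒x≤y (in-cell rootNumerator a*-cell (con 10 :* var 0F :- one) ≡.refl))
    (≤-trans (*-monoˡ-≤ (fromℕ-nonneg 10) a*≤0) (≤-reflexive (zeroʳ _)))))

  a*<1 : a* < 1#
  a*<1 = ≰⇒> λ 1≤a* → 0≉1 (≤-antisym 0≤1 (≤-resp
    (solve 0 (con 10 :* one :- con 9 := one) ≡.refl) (-‿inverseʳ (fromℕ 9))
    (+-monoˡ-≤ (- fromℕ 9) (≤-trans (*-monoˡ-≤ (fromℕ-nonneg 10) 1≤a*)
      (0≤y-x⇒x≤y (in-cell rootNumerator a*-cell (con 9 :- con 10 :* var 0F) ≡.refl))))))

  private
    module K = Constants (K isRoot 0≤a*≤1)

  value : Carrier
  value = K.α * K.L ⁻¹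

  private
    2·10¹⁰ : Carrier
    2·10¹⁰ = fromℕ 2 * fromℕ 10 ^ 10

    10¹⁰-pos : 0# < fromℕ 10 ^ 10
    10¹⁰-pos = <-≤-trans (fromℕ-pos 10000000000)
      (≤-reflexive (solve 0 (con 10000000000 := con 10 :^ 10) ≡.refl))

    2·10¹⁰-pos : 0# < 2·10¹⁰
    2·10¹⁰-pos = <-≤-trans (fromℕ-pos 20000000000)
      (≤-reflexive (solve 0 (con 20000000000 := con 2 :* con 10 :^ 10) ≡.refl))

    -- Multiplication by `2·10¹⁰` clears the power of ten together with the half unit of rounding,
    -- leaving inequalities with integer coefficients.
    rounds : ∀ {x} c → fromℕ 2 * c - 1# ≤ 2·10¹⁰ * x → 2·10¹⁰ * x ≤ fromℕ 2 * c + 1# →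
      x ≈ c / fromℕ 10 ^ 10 ± (½ / fromℕ 10 ^ 10)
    rounds {x} c below above =
        *-cancelˡ-≤ 2·10¹⁰-pos (≤-trans (≤-reflexive (trans
          (solve 4 (λ d i c h → con 2 :* d :* (c :* i :- h :* i) := (con 2 :* c :- con 2 :* h) :* (d :* i)) ≡.refl D (D ⁻¹) c ½)
          (trans (*-congˡ DD⁻¹≈1) (trans (*-identityʳ _) (+-congˡ (-‿cong 2½≈1)))))) below)
      , *-cancelˡ-≤ 2·10¹⁰-pos (≤-trans above (≤-reflexive (sym (trans
          (solve 4 (λ d i c h → con 2 :* d :* (c :* i :+ h :* i) := (con 2 :* c :+ con 2 :* h) :* (d :* i)) ≡.refl D (D ⁻¹) c ½)
          (trans (*-congˡ DD⁻¹≈1) (trans (*-identityʳ _) (+-congˡ 2½≈1)))))))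
      where
      D = fromℕ 10 ^ 10
      DD⁻¹≈1 : D * D ⁻¹ ≈ 1#
      DD⁻¹≈1 = *-inverse-pos 10¹⁰-pos

    αᴱ Lᴱ 2·10¹⁰ᴱ : Expr 2
    αᴱ      = Certificate.α (var 0F) (var 1F)
    Lᴱ      = Certificate.L (var 0F) (var 1F)
    2·10¹⁰ᴱ = con 2 :* con 10 :^ 10

    certify-a* : (l r : Expr 2) → nonneg? 1 0 (swap 0 (zoom 1 rootScale rootNumerator (normalise (r :- l)))) ≡ true →
      ⟦ l ⟧ (a* ∷ 0# ∷ []) ≤ ⟦ r ⟧ (a* ∷ 0# ∷ [])
    certify-a* l r eq = 0≤y-x⇒x≤y (in-cell rootNumerator a*-cell (r :- l) eq)

  a*≈ : a* ≈10⁻¹⁰× 1992570042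
  a*≈ = rounds (fromℕ 1992570042)
    (certify-a* (con 2 :* con 1992570042 :- one) (2·10¹⁰ᴱ :* var 0F) ≡.refl)
    (certify-a* (2·10¹⁰ᴱ :* var 0F) (con 2 :* con 1992570042 :+ one) ≡.refl)

  private
    divide : ∀ c → (c * K.L) * K.L ⁻¹ ≈ c
    divide c = trans (*-assoc _ _ _) (trans (*-congˡ (*-inverse-pos K.0<L)) (*-identityʳ c))

    α-lower : (fromℕ 2 * fromℕ 64670988308 - 1#) * K.L ≤ 2·10¹⁰ * K.α
    α-lower = certify-a* ((con 2 :* con 64670988308 :- one) :* Lᴱ) (2·10¹⁰ᴱ :* αᴱ) ≡.refl

    α-upper : 2·10¹⁰ * K.α ≤ (fromℕ 2 * fromℕ 64670988308 + 1#) * K.L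
    α-upper = certify-a* (2·10¹⁰ᴱ :* αᴱ) ((con 2 :* con 64670988308 :+ one) :* Lᴱ) ≡.refl

    0≤L⁻¹ : 0# ≤ K.L ⁻¹
    0≤L⁻¹ = ⁻¹-pos K.0<L

  value≈ : value ≈10⁻¹⁰× 64670988308
  value≈ = rounds (fromℕ 64670988308)
    (≤-resp (divide _) (*-assoc _ _ _) (*-monoʳ-≤ 0≤L⁻¹ α-lower))
    (≤-resp (*-assoc _ _ _) (divide _) (*-monoʳ-≤ 0≤L⁻¹ α-upper))

  private
    value-lower : ∀ y → (∃ λ a → Admissible a × y ≈∞ 𝔼[T] 1 a) → fin value ≤∞ y
    value-lower y (a , adm , y≈) = ≤∞-respʳ (fin value) y (𝔼[T] 1 a) y≈
      (States.V≤𝔼[T] adm (constants isRoot (proj₁ adm 1) (proj₁ adm 2)))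

  R≈value : R 1 ≈∞ fin value
  R≈value = inf∞-attained _ (*-nonneg (≤-trans (*-nonneg (fromℕ-nonneg 5) (proj₁ K.0<L)) K.5L≤α) 0≤L⁻¹) value-lower
    (strategy isRoot 0≤a*≤1 , admissible isRoot 0≤a*≤1 , ≈∞-sym (𝔼[T] 1 (strategy isRoot 0≤a*≤1)) (fin value) (𝔼[T]≈ isRoot 0≤a*≤1))

theorem1 : (em : ExcludedMiddle 0ℓ) (ℝ : CompleteOrderedField) →
           let open CompleteOrderedField ℝ
               open Rendezvous em ℝ in
           (∃ λ r → R 1 ≈∞ fin r × r ≈10⁻¹⁰× 64670988308) ×
           (∃ λ a* →
             (0# < a* × a* < 1# × quartic a* ≈ 0#) ×
             (∀ x → 0# < x → x < 1# → quartic x ≈ 0# → x ≈ a*) ×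
             a* ≈10⁻¹⁰× 1992570042 ×
             R 1 ≈∞ U 1 2 (a* ∷ []) ×
             Admissible (extend (a* ∷ [])) ×
             R 1 ≈∞ 𝔼[T] 1 (extend (a* ∷ [])))
theorem1 em ℝ =
  (value , R≈value , value≈) ,
  (a* ,
    (0<a* , a*<1 , proj₂ (proj₂ isRoot)) ,
    (λ x 0<x x<1 qx≈0 → quartic-root-unique (proj₁ 0<x , proj₁ x<1) 0≤a*≤1 qx≈0 (proj₂ (proj₂ isRoot))) ,
    a*≈ ,
    ≈∞-join (R 1) (U 1 2 (a* ∷ [])) (fin value) R≈value (U≈ isRoot 0≤a*≤1) ,
    admissible isRoot 0≤a*≤1 ,
    ≈∞-join (R 1) (𝔼[T] 1 (extend (a* ∷ []))) (fin value) R≈value (𝔼[T]≈ isRoot 0≤a*≤1))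
  where
  open Rendezvous em ℝ
  open ExtendedReals em ℝ
  open Exact em ℝ
  open QuarticRoot em ℝ
  open Optimum em ℝ
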